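{- There is a computable function $m(j,\varepsilon)$ with the following property. There is an oracle algorithm which, given a representation of a shift-invariant Borel probability measure $\mu$ on $2^{\mathbb{N}}$, computes a point $\omega \in 2^{\mathbb{N}}$ that is generic for $\mu$ and moreover satisfies: for every finite binary string $\sigma$ of length $j$, every $\varepsilon > 0$, and every $n \geq m(j,\varepsilon)$, \[ \left| \mu([\sigma]) - \frac{1}{n} \sum_{i < n} 1_{[\sigma]} (T^i \omega) \right| < \varepsilon. \] (The function $m$ does not depend on $\mu$.)
   Context: $2^{\mathbb{N}}$ is Cantor space; $[\sigma]$ is the set of infinite binary sequences extending the finite string $\sigma$; $T$ is the left shift $(T\omega)(k)=\omega(k+1)$; shift-invariance means $\mu(T^{ -1}B)=\mu(B)$ for all Borel $B$. A representation of $\mu$ is a function $f$ from (finite binary strings)$\times\mathbb{N}$ to $\mathbb{Q}$ with $|\mu([\sigma]) - f(\sigma,i)| < 2^{ -i}$; computing $\omega$ means computing the function $k\mapsto\omega(k)$, with finitely many queries to the representation for each output bit. A point $\omega$ is generic for $\mu$ if for every finite binary string $\sigma$, $\mu([\sigma]) = \lim_{n\to\infty} \frac1n\sum_{i<n} 1_{[\sigma]}(T^i\omega)$. -}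

module Defs where

open import Data.Bool using (Bool; true; false; _∧_; if_then_else_)
open import Data.List using (List; []; _∷_; length)
open import Data.Nat using (ℕ; zero; suc; _+_)
open import Data.Integer using (+_)
open import Data.Rational using (ℚ; 0ℚ; 1ℚ; ½; _-_; ∣_∣; _<_; _≤_; _/_; -_)
  renaming (_+_ to _+ℚ_; _*_ to _*ℚ_)
open import Data.Product using (Σ; ∃; _×_)

Str : Set
Str = List Bool

Point : Set
Point = ℕ → Bool

2^-_ : ℕ → ℚ
2^- zero = 1ℚ
2^- suc n = ½ *ℚ (2^- n)

-- Cauchy reals (Bishop style): regular sequences of rationals,
-- |x m - x n| ≤ 2^-m + 2^-n ; the limit x satisfies |x - x n| ≤ 2^-n.

record ℝ : Set where
  field
    seq : ℕ → ℚ
    reg : ∀ m n → ∣ seq m - seq n ∣ ≤ (2^- m) +ℚ (2^- n)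
open ℝ public

_≃_ : ℝ → ℝ → Set
x ≃ y = ∀ n → ∣ seq x n - seq y n ∣ ≤ (2^- n) +ℚ (2^- n)

-- x ≃ y ⊕ z, where (y ⊕ z) n = y (n+1) + z (n+1) is the usual sum of
-- regular sequences (written unfolded to avoid proving its regularity here)
_≃_⊕_ : ℝ → ℝ → ℝ → Set
x ≃ y ⊕ z = ∀ n → ∣ seq x n - (seq y (suc n) +ℚ seq z (suc n)) ∣ ≤ (2^- n) +ℚ (2^- n)

_≃ℚ_ : ℝ → ℚ → Set
x ≃ℚ q = ∀ n → ∣ seq x n - q ∣ ≤ (2^- n) +ℚ (2^- n)

NonNeg : ℝ → Set
NonNeg x = ∀ n → - (2^- n) ≤ seq x n

-- | x - q | < r  for a real x and rationals q, r
DistLt : ℝ → ℚ → ℚ → Set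
DistLt x q r = ∃ λ n → (∣ seq x n - q ∣ +ℚ (2^- n)) < r

-- A Borel probability measure μ on 2^ℕ is determined by (and,
-- by Carathéodory, corresponds exactly to) its values ν σ = μ([σ]) on
-- cylinders, subject to ν [] = 1, ν σ ≥ 0, ν σ = ν (σ0) + ν (σ1).
-- Shift invariance μ(T⁻¹B) = μ(B) amounts to ν σ = ν (0σ) + ν (1σ),
-- since T⁻¹[σ] = [0σ] ∪ [1σ].

snoc : Str → Bool → Str
snoc [] b = b ∷ []
snoc (c ∷ σ) b = c ∷ snoc σ b

record IsShiftInvProbMeasure (ν : Str → ℝ) : Set where
  field
    total    : ν [] ≃ℚ 1ℚ
    nonneg   : ∀ σ → NonNeg (ν σ)
    additive : ∀ σ → ν σ ≃ ν (snoc σ false) ⊕ ν (snoc σ true)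
    shiftInv : ∀ σ → ν σ ≃ ν (false ∷ σ) ⊕ ν (true ∷ σ)

Rep : Set
Rep = Str → ℕ → ℚ

IsRepresentation : (Str → ℝ) → Rep → Set
IsRepresentation ν f = ∀ σ i → DistLt (ν σ) (f σ i) (2^- i)

shift : ℕ → Point → Point
shift i ω k = ω (i + k)

eqB : Bool → Bool → Bool
eqB true b = b
eqB false b = if b then false else true

inCyl : Str → Point → Bool
inCyl [] ω = true
inCyl (b ∷ σ) ω = eqB b (ω 0) ∧ inCyl σ (λ k → ω (suc k))

count : Str → Point → ℕ → ℕ
count σ ω zero = zero
count σ ω (suc n) = count σ ω n + (if inCyl σ (shift n ω) then 1 else 0)

-- (1/n) Σ_{i<n} 1_[σ](T^i ω), for n = suc k ≥ 1
avg : Str → Point → ℕ → ℚ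
avg σ ω k = (+ count σ ω (suc k)) / suc k

-- ω is generic for μ (ε ranging over positive rationals suffices)
Generic : (Str → ℝ) → Point → Set
Generic ν ω = ∀ σ (ε : ℚ) → 0ℚ < ε →
  ∃ λ N → ∀ k → N Data.Nat.≤ suc k → DistLt (ν σ) (avg σ ω k) ε

-- The integer weight g_k(τ) = ⌊2^k f(τ, k + 4)⌋ is within a constant of 2^k μ[τ], and the
-- relations μ[τ] = μ[τ0] + μ[τ1] = μ[0τ] + μ[1τ] make it additive up to a constant, both on
-- the right and on the left. The level-J block concatenates, for every word τ of length J,
-- g_{2J+4}(τ) copies of τ; ω concatenates units 0·(level-J block), each level J being used for
-- more units than J + 1 times the length of a level-(J + 1) unit. Summing over the
-- decompositions τ = α σ β, the two additivities show that σ occurs with weight ≈ g(σ) at each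
-- position inside the copies; the windows straddling two copies (|σ| of them per copy of
-- length J) and the rounding errors make up less than 2^-L of a block once J ≥ 32·2^L(|σ| + 1).
-- The units of earlier levels and the one containing the end of the prefix are negligible
-- after m(|σ|, ε) symbols, a bound computed from |σ| and ε alone.
module Submission where

module NatApprox where

  open import Data.Nat
  open import Data.Nat.Properties
  open import Data.Product using (_×_; _,_)
  open import Algebra.Properties.CommutativeSemigroup +-commutativeSemigroup using (interchange)
  open import Relation.Binary.PropositionalEquality

  infix 4 _≈[_]_ _≤_≤+_

  _≈[_]_ : ℕ → ℕ → ℕ → Set
  x ≈[ e ] y = (x ≤ y + e) × (y ≤ x + e)

  _≤_≤+_ : ℕ → ℕ → ℕ → Set
  L ≤ x ≤+ e = (L ≤ x) × (x ≤ L + e)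

  ≈-refl : ∀ {x} → x ≈[ 0 ] x
  ≈-refl {x} = ≤-reflexive (sym (+-identityʳ x)) , ≤-reflexive (sym (+-identityʳ x))

  ≈-sym : ∀ {x e y} → x ≈[ e ] y → y ≈[ e ] x
  ≈-sym (a , b) = b , a

  ≈-trans : ∀ {x e y f z} → x ≈[ e ] y → y ≈[ f ] z → x ≈[ e + f ] z
  ≈-trans {x} {e} {y} {f} {z} (a , b) (c , d) =
    ≤-trans a (≤-trans (+-monoˡ-≤ e c) (≤-reflexive (trans (+-assoc z f e) (cong (z +_) (+-comm f e))))) ,
    ≤-trans d (≤-trans (+-monoˡ-≤ f b) (≤-reflexive (+-assoc x e f)))

  ≈-+ : ∀ {x e y x' e' y'} → x ≈[ e ] y → x' ≈[ e' ] y' → x + x' ≈[ e + e' ] y + y'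
  ≈-+ {x} {e} {y} {x'} {e'} {y'} (a , b) (c , d) =
    ≤-trans (+-mono-≤ a c) (≤-reflexive (interchange y e y' e')) ,
    ≤-trans (+-mono-≤ b d) (≤-reflexive (interchange x e x' e'))

  ≈-*ˡ : ∀ a {x e y} → x ≈[ e ] y → a * x ≈[ a * e ] a * y
  ≈-*ˡ a {x} {e} {y} (b , c) =
    ≤-trans (*-monoʳ-≤ a b) (≤-reflexive (*-distribˡ-+ a y e)) ,
    ≤-trans (*-monoʳ-≤ a c) (≤-reflexive (*-distribˡ-+ a x e))

  ≈-congˡ : ∀ {x x' e y} → x ≡ x' → x ≈[ e ] y → x' ≈[ e ] y
  ≈-congˡ refl p = p

  ≈-congʳ : ∀ {x e y y'} → y ≡ y' → x ≈[ e ] y → x ≈[ e ] y'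
  ≈-congʳ refl p = p

  ≈-cong-error : ∀ {x e e' y} → e ≡ e' → x ≈[ e ] y → x ≈[ e' ] y
  ≈-cong-error refl p = p

  ≈-weaken : ∀ {x e y e'} → e ≤ e' → x ≈[ e ] y → x ≈[ e' ] y
  ≈-weaken le (a , b) = ≤-trans a (+-monoʳ-≤ _ le) , ≤-trans b (+-monoʳ-≤ _ le)

  ≈-+error : ∀ x e → x ≈[ e ] x + e
  ≈-+error x e = ≤-trans (m≤m+n x e) (m≤m+n (x + e) e) , ≤-refl

  ≤≤+⇒≈ : ∀ {L x e} → L ≤ x ≤+ e → x ≈[ e ] L
  ≤≤+⇒≈ {L} {x} {e} (a , b) = b , ≤-trans a (m≤m+n x e)

  ≤≤+-trans : ∀ {a b c e e'} → a ≤ b ≤+ e → b ≤ c ≤+ e' → a ≤ c ≤+ (e + e')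
  ≤≤+-trans {a} {b} {c} {e} {e'} (a≤b , b≤a+e) (b≤c , c≤b+e') =
    ≤-trans a≤b b≤c , ≤-trans c≤b+e' (≤-trans (+-monoˡ-≤ e' b≤a+e) (≤-reflexive (+-assoc a e e')))

  ≤≤+-weaken : ∀ {L x e e'} → L ≤ x ≤+ e → e ≤ e' → L ≤ x ≤+ e'
  ≤≤+-weaken (L≤x , x≤L+e) e≤e' = L≤x , ≤-trans x≤L+e (+-monoʳ-≤ _ e≤e')

  ≤≤+-+ : ∀ {L₁ x₁ e₁ L₂ x₂ e₂} → L₁ ≤ x₁ ≤+ e₁ → L₂ ≤ x₂ ≤+ e₂ → L₁ + L₂ ≤ x₁ + x₂ ≤+ (e₁ + e₂)
  ≤≤+-+ {L₁} {x₁} {e₁} {L₂} {x₂} {e₂} (a , b) (c , d) =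
    +-mono-≤ a c , ≤-trans (+-mono-≤ b d) (≤-reflexive (interchange L₁ e₁ L₂ e₂))

  n≤2^n : ∀ n → n ≤ 2 ^ n
  n≤2^n zero = z≤n
  n≤2^n (suc n) = ≤-trans (+-mono-≤ (m^n>0 2 n) (n≤2^n n))
    (≤-reflexive (cong (2 ^ n +_) (sym (+-identityʳ (2 ^ n)))))

module RationalApprox where

  open import Defs
  open import Data.Rational
  open import Data.Rational.Properties
  open import Data.Rational.Solver
  open import Data.Rational.Literals using (fromℤ)
  open import Data.Rational.Unnormalised as U using (mkℚᵘ)
  import Data.Rational.Unnormalised.Properties as U
  open import Data.Integer using (-[1+_]; +≤+; +<+)
  import Data.Integer as ℤ
  import Data.Integer.Properties as ℤ
  open import Data.Nat using (ℕ; zero; suc)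
  import Data.Nat as ℕ
  import Data.Nat.Properties as ℕ
  import Data.Nat.DivMod as ℕ
  open import Data.Product using (_×_; _,_)
  open import Data.Sum using (inj₁; inj₂)
  open import Relation.Binary.PropositionalEquality
  open import Relation.Nullary using (yes; no; contradiction)
  open +-*-Solver using (solve; _:+_; _:*_; _:-_; :-_; _:=_; con)

  0≤1 : 0ℚ ≤ 1ℚ
  0≤1 = *≤* (+≤+ ℕ.z≤n)

  0<1 : 0ℚ < 1ℚ
  0<1 = *<* (+<+ (ℕ.s≤s ℕ.z≤n))

  a-b≤e⇒a≤b+e : ∀ {a b e} → a - b ≤ e → a ≤ b + e
  a-b≤e⇒a≤b+e {a} {b} {e} h = begin
    a             ≡⟨ solve 2 (λ a b → a := b :+ (a :- b)) refl a b ⟩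
    b + (a - b)   ≤⟨ +-monoʳ-≤ b h ⟩
    b + e ∎
    where open ≤-Reasoning

  a≤b+e⇒a-b≤e : ∀ {a b e} → a ≤ b + e → a - b ≤ e
  a≤b+e⇒a-b≤e {a} {b} {e} h = begin
    a - b         ≤⟨ +-monoˡ-≤ (- b) h ⟩
    b + e - b     ≡⟨ solve 2 (λ b e → b :+ e :- b := e) refl b e ⟩
    e ∎
    where open ≤-Reasoning

  a≤b+e⇒a-e≤b : ∀ {a b e} → a ≤ b + e → a - e ≤ b
  a≤b+e⇒a-e≤b {a} {b} {e} h = begin
    a - e         ≤⟨ +-monoˡ-≤ (- e) h ⟩
    b + e - e     ≡⟨ solve 2 (λ b e → b :+ e :- e := b) refl b e ⟩
    b ∎
    where open ≤-Reasoning

  p≤∣p∣ : ∀ p → p ≤ ∣ p ∣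
  p≤∣p∣ p with ∣p∣≡p∨∣p∣≡-p p
  ... | inj₁ ∣p∣≡p = ≤-reflexive (sym ∣p∣≡p)
  ... | inj₂ ∣p∣≡-p = ≤-trans p≤0 (0≤∣p∣ p)
    where
    p≤0 : p ≤ 0ℚ
    p≤0 = subst₂ _≤_ (solve 1 (λ p → :- (:- p) := p) refl p) refl
            (neg-antimono-≤ (subst (0ℚ ≤_) ∣p∣≡-p (0≤∣p∣ p)))

  -p≤∣p∣ : ∀ p → - p ≤ ∣ p ∣
  -p≤∣p∣ p = subst (- p ≤_) (∣-p∣≡∣p∣ p) (p≤∣p∣ (- p))

  infix 4 _≈[_]_

  _≈[_]_ : ℚ → ℚ → ℚ → Set
  x ≈[ e ] y = (x ≤ y + e) × (y ≤ x + e)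

  ∣-∣≤⇒≈ : ∀ {x y e} → ∣ x - y ∣ ≤ e → x ≈[ e ] y
  ∣-∣≤⇒≈ {x} {y} {e} h = a-b≤e⇒a≤b+e (≤-trans (p≤∣p∣ (x - y)) h) ,
    a-b≤e⇒a≤b+e (≤-trans (≤-reflexive (solve 2 (λ x y → y :- x := :- (x :- y)) refl x y))
                        (≤-trans (-p≤∣p∣ (x - y)) h))

  ≈⇒∣-∣≤ : ∀ {x y e} → x ≈[ e ] y → ∣ x - y ∣ ≤ e
  ≈⇒∣-∣≤ {x} {y} {e} (x≤y+e , y≤x+e) with ∣p∣≡p∨∣p∣≡-p (x - y)
  ... | inj₁ eq = subst (_≤ e) (sym eq) (a≤b+e⇒a-b≤e x≤y+e)
  ... | inj₂ eq = subst (_≤ e) (sym eq)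
     (≤-trans (≤-reflexive (solve 2 (λ x y → :- (x :- y) := y :- x) refl x y)) (a≤b+e⇒a-b≤e y≤x+e))

  ≈-sym : ∀ {x e y} → x ≈[ e ] y → y ≈[ e ] x
  ≈-sym (a , b) = b , a

  ≈-trans : ∀ {x e y f z} → x ≈[ e ] y → y ≈[ f ] z → x ≈[ e + f ] z
  ≈-trans {x} {e} {y} {f} {z} (a , b) (c , d) =
    ≤-trans a (≤-trans (+-monoˡ-≤ e c) (≤-reflexive (solve 3 (λ z f e → z :+ f :+ e := z :+ (e :+ f)) refl z f e))) ,
    ≤-trans d (≤-trans (+-monoˡ-≤ f b) (≤-reflexive (+-assoc x e f)))

  ≈-+ : ∀ {x e y x' e' y'} → x ≈[ e ] y → x' ≈[ e' ] y' → x + x' ≈[ e + e' ] y + y'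
  ≈-+ {x} {e} {y} {x'} {e'} {y'} (a , b) (c , d) =
    ≤-trans (+-mono-≤ a c) (≤-reflexive (interchange y e y' e')) ,
    ≤-trans (+-mono-≤ b d) (≤-reflexive (interchange x e x' e'))
    where
    interchange : ∀ (a b c d : ℚ) → a + b + (c + d) ≡ a + c + (b + d)
    interchange = solve 4 (λ a b c d → a :+ b :+ (c :+ d) := a :+ c :+ (b :+ d)) refl

  ≈-weaken : ∀ {x e y e'} → e ≤ e' → x ≈[ e ] y → x ≈[ e' ] y
  ≈-weaken {x} {e} {y} {e'} e≤e' (a , b) = ≤-trans a (+-monoʳ-≤ y e≤e') , ≤-trans b (+-monoʳ-≤ x e≤e')

  ≈-congˡ : ∀ {x x' e y} → x ≡ x' → x ≈[ e ] y → x' ≈[ e ] y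
  ≈-congˡ refl p = p

  ≈-congʳ : ∀ {x e y y'} → y ≡ y' → x ≈[ e ] y → x ≈[ e ] y'
  ≈-congʳ refl p = p

  ≈-cong-error : ∀ {x e e' y} → e ≡ e' → x ≈[ e ] y → x ≈[ e' ] y
  ≈-cong-error refl p = p

  ≈-*ˡ : ∀ c .{{_ : NonNegative c}} {x e y} → x ≈[ e ] y → c * x ≈[ c * e ] c * y
  ≈-*ˡ c {x} {e} {y} (a , b) =
    ≤-trans (*-monoˡ-≤-nonNeg c a) (≤-reflexive (*-distribˡ-+ c y e)) ,
    ≤-trans (*-monoˡ-≤-nonNeg c b) (≤-reflexive (*-distribˡ-+ c x e))

  ≈-cancel-*ˡ : ∀ c .{{_ : Positive c}} {x e y} → c * x ≈[ c * e ] c * y → x ≈[ e ] y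
  ≈-cancel-*ˡ c {x} {e} {y} (a , b) =
    *-cancelˡ-≤-pos c (≤-trans a (≤-reflexive (sym (*-distribˡ-+ c y e)))) ,
    *-cancelˡ-≤-pos c (≤-trans b (≤-reflexive (sym (*-distribˡ-+ c x e))))

  -- the embedding of ℕ, by recursion so that it computes on numerals
  ⟦_⟧ : ℕ → ℚ
  ⟦ zero ⟧ = 0ℚ
  ⟦ suc n ⟧ = 1ℚ + ⟦ n ⟧

  ⟦⟧-+ : ∀ a b → ⟦ a ℕ.+ b ⟧ ≡ ⟦ a ⟧ + ⟦ b ⟧
  ⟦⟧-+ zero b = sym (+-identityˡ ⟦ b ⟧)
  ⟦⟧-+ (suc a) b = trans (cong (1ℚ +_) (⟦⟧-+ a b)) (sym (+-assoc 1ℚ ⟦ a ⟧ ⟦ b ⟧))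

  ⟦⟧-* : ∀ a b → ⟦ a ℕ.* b ⟧ ≡ ⟦ a ⟧ * ⟦ b ⟧
  ⟦⟧-* zero b = sym (*-zeroˡ ⟦ b ⟧)
  ⟦⟧-* (suc a) b = trans (⟦⟧-+ b (a ℕ.* b)) (trans (cong (⟦ b ⟧ +_) (⟦⟧-* a b))
    (solve 2 (λ x y → y :+ x :* y := (con 1ℚ :+ x) :* y) refl ⟦ a ⟧ ⟦ b ⟧))

  ⟦⟧-nonNeg : ∀ n → 0ℚ ≤ ⟦ n ⟧
  ⟦⟧-nonNeg zero = ≤-refl
  ⟦⟧-nonNeg (suc n) = ≤-trans (≤-reflexive (sym (+-identityʳ 0ℚ))) (+-mono-≤ 0≤1 (⟦⟧-nonNeg n))

  ⟦⟧-nonNegative : ∀ n → NonNegative ⟦ n ⟧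
  ⟦⟧-nonNegative n = nonNegative (⟦⟧-nonNeg n)

  ⟦suc⟧-positive : ∀ n → Positive ⟦ suc n ⟧
  ⟦suc⟧-positive n = positive (<-≤-trans (subst (_< 1ℚ + 0ℚ) (+-identityʳ 0ℚ) (+-monoˡ-< 0ℚ 0<1))
    (+-monoʳ-≤ 1ℚ (⟦⟧-nonNeg n)))

  ⟦⟧-mono : ∀ {a b} → a ℕ.≤ b → ⟦ a ⟧ ≤ ⟦ b ⟧
  ⟦⟧-mono {a} {b} a≤b = subst (λ z → ⟦ a ⟧ ≤ ⟦ z ⟧) (ℕ.m+[n∸m]≡n a≤b)
    (subst (⟦ a ⟧ ≤_) (sym (⟦⟧-+ a (b ℕ.∸ a)))
      (≤-trans (≤-reflexive (sym (+-identityʳ ⟦ a ⟧))) (+-monoʳ-≤ ⟦ a ⟧ (⟦⟧-nonNeg (b ℕ.∸ a)))))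

  ⟦⟧-cancel-≤ : ∀ {a b} → ⟦ a ⟧ ≤ ⟦ b ⟧ → a ℕ.≤ b
  ⟦⟧-cancel-≤ {a} {b} ⟦a⟧≤⟦b⟧ with a ℕ.≤? b
  ... | yes a≤b = a≤b
  ... | no a≰b = contradiction (<-≤-trans ⟦b⟧<⟦b+1⟧ (≤-trans (⟦⟧-mono (ℕ.≰⇒> a≰b)) ⟦a⟧≤⟦b⟧)) (<-irrefl refl)
    where
    ⟦b⟧<⟦b+1⟧ : ⟦ b ⟧ < ⟦ suc b ⟧
    ⟦b⟧<⟦b+1⟧ = subst (_< 1ℚ + ⟦ b ⟧) (+-identityˡ ⟦ b ⟧) (+-monoˡ-< ⟦ b ⟧ 0<1)

  ⟦⟧≡fromℤ : ∀ n → ⟦ n ⟧ ≡ fromℤ (ℤ.+ n)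
  ⟦⟧≡fromℤ zero = refl
  ⟦⟧≡fromℤ (suc n) = trans (cong (1ℚ +_) (⟦⟧≡fromℤ n)) (toℚᵘ-injective
    (U.≃-trans (toℚᵘ-homo-+ 1ℚ (fromℤ (ℤ.+ n))) (U.*≡* (lemma n))))
    where
    lemma : ∀ n → (ℤ.+ 1 ℤ.* ℤ.+ 1 ℤ.+ ℤ.+ n ℤ.* ℤ.+ 1) ℤ.* ℤ.+ 1 ≡ ℤ.+ suc n ℤ.* (ℤ.+ 1 ℤ.* ℤ.+ 1)
    lemma n = trans (ℤ.*-identityʳ (ℤ.+ 1 ℤ.* ℤ.+ 1 ℤ.+ ℤ.+ n ℤ.* ℤ.+ 1))
      (trans (cong (ℤ._+_ (ℤ.+ 1)) (ℤ.*-identityʳ (ℤ.+ n))) (sym (ℤ.*-identityʳ (ℤ.+ suc n))))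

  ⟦⟧-*-/-cancel : ∀ C k p → toℚᵘ p U.≃ mkℚᵘ (ℤ.+ C) k → ⟦ suc k ⟧ * p ≡ ⟦ C ⟧
  ⟦⟧-*-/-cancel C k p p≃C/k+1 = toℚᵘ-injective (U.≃-trans (toℚᵘ-homo-* ⟦ suc k ⟧ p)
    (U.≃-trans (U.*-cong (U.≃-reflexive (cong toℚᵘ (⟦⟧≡fromℤ (suc k)))) p≃C/k+1)
    (U.≃-trans (U.*≡* lemma) (U.≃-reflexive (cong toℚᵘ (sym (⟦⟧≡fromℤ C)))))))
    where
    lemma : (ℤ.+ suc k ℤ.* ℤ.+ C) ℤ.* ℤ.+ 1 ≡ ℤ.+ C ℤ.* (ℤ.+ 1 ℤ.* ℤ.+ suc k)
    lemma = trans (ℤ.*-identityʳ (ℤ.+ suc k ℤ.* ℤ.+ C))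
      (trans (ℤ.*-comm (ℤ.+ suc k) (ℤ.+ C)) (cong (ℤ._*_ (ℤ.+ C)) (sym (ℤ.*-identityˡ (ℤ.+ suc k)))))

  ≈-⟦⟧ : ∀ {a b c} → a NatApprox.≈[ c ] b → ⟦ a ⟧ ≈[ ⟦ c ⟧ ] ⟦ b ⟧
  ≈-⟦⟧ {a} {b} {c} (a≤b+c , b≤a+c) =
    ≤-trans (⟦⟧-mono a≤b+c) (≤-reflexive (⟦⟧-+ b c)) , ≤-trans (⟦⟧-mono b≤a+c) (≤-reflexive (⟦⟧-+ a c))

  ≈-⟦⟧⁻¹ : ∀ {a b c : ℕ} {e : ℚ} → ⟦ a ⟧ ≈[ e ] ⟦ b ⟧ → e ≤ ⟦ c ⟧ → a NatApprox.≈[ c ] b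
  ≈-⟦⟧⁻¹ {a} {b} {c} {e} (a≤b+e , b≤a+e) e≤c =
    ⟦⟧-cancel-≤ (≤-trans a≤b+e (≤-trans (+-monoʳ-≤ ⟦ b ⟧ e≤c) (≤-reflexive (sym (⟦⟧-+ b c))))) ,
    ⟦⟧-cancel-≤ (≤-trans b≤a+e (≤-trans (+-monoʳ-≤ ⟦ a ⟧ e≤c) (≤-reflexive (sym (⟦⟧-+ a c)))))

  2^-pos : ∀ n → 0ℚ < 2^- n
  2^-pos zero = 0<1
  2^-pos (suc n) = subst (_< ½ * 2^- n) (*-zeroʳ ½) (*-monoʳ-<-pos ½ (2^-pos n))

  2^-nonNegative : ∀ n → NonNegative (2^- n)
  2^-nonNegative n = nonNegative (<⇒≤ (2^-pos n))

  2^-+ : ∀ k m → 2^- (k ℕ.+ m) ≡ 2^- k * 2^- m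
  2^-+ zero m = sym (*-identityˡ (2^- m))
  2^-+ (suc k) m = trans (cong (½ *_) (2^-+ k m)) (sym (*-assoc ½ (2^- k) (2^- m)))

  2^-suc≤ : ∀ n → 2^- (suc n) ≤ 2^- n
  2^-suc≤ n = subst (2^- (suc n) ≤_) (solve 1 (λ x → con ½ :* x :+ con ½ :* x := x) refl (2^- n))
    (subst (_≤ 2^- (suc n) + 2^- (suc n)) (+-identityˡ (2^- (suc n)))
      (+-monoˡ-≤ (2^- (suc n)) (<⇒≤ (2^-pos (suc n)))))

  2^-antimono : ∀ {m n} → m ℕ.≤ n → 2^- n ≤ 2^- m
  2^-antimono {m} {n} m≤n = subst (λ z → 2^- z ≤ 2^- m) (ℕ.m+[n∸m]≡n m≤n) (extend m (n ℕ.∸ m))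
    where
    extend : ∀ m d → 2^- (m ℕ.+ d) ≤ 2^- m
    extend m zero = ≤-reflexive (cong 2^-_ (ℕ.+-identityʳ m))
    extend m (suc d) = ≤-trans (≤-reflexive (cong 2^-_ (ℕ.+-suc m d))) (≤-trans (2^-suc≤ (m ℕ.+ d)) (extend m d))

  2^*2^- : ∀ k → ⟦ 2 ℕ.^ k ⟧ * 2^- k ≡ 1ℚ
  2^*2^- zero = refl
  2^*2^- (suc k) = begin
    ⟦ 2 ℕ.* 2 ℕ.^ k ⟧ * (½ * 2^- k) ≡⟨ cong (_* (½ * 2^- k)) (⟦⟧-* 2 (2 ℕ.^ k)) ⟩
    ⟦ 2 ⟧ * ⟦ 2 ℕ.^ k ⟧ * (½ * 2^- k)
      ≡⟨ solve 4 (λ a b c d → a :* b :* (c :* d) := (a :* c) :* (b :* d)) refl ⟦ 2 ⟧ ⟦ 2 ℕ.^ k ⟧ ½ (2^- k) ⟩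
    (⟦ 2 ⟧ * ½) * (⟦ 2 ℕ.^ k ⟧ * 2^- k) ≡⟨ cong ((⟦ 2 ⟧ * ½) *_) (2^*2^- k) ⟩
    1ℚ ∎
    where open ≡-Reasoning

  2^-*2^ : ∀ k → 2^- k * ⟦ 2 ℕ.^ k ⟧ ≡ 1ℚ
  2^-*2^ k = trans (*-comm (2^- k) ⟦ 2 ℕ.^ k ⟧) (2^*2^- k)

  2^*2^-+ : ∀ k m → ⟦ 2 ℕ.^ k ⟧ * 2^- (k ℕ.+ m) ≡ 2^- m
  2^*2^-+ k m = begin
    ⟦ 2 ℕ.^ k ⟧ * 2^- (k ℕ.+ m) ≡⟨ cong (⟦ 2 ℕ.^ k ⟧ *_) (2^-+ k m) ⟩
    ⟦ 2 ℕ.^ k ⟧ * (2^- k * 2^- m) ≡⟨ sym (*-assoc ⟦ 2 ℕ.^ k ⟧ (2^- k) (2^- m)) ⟩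
    (⟦ 2 ℕ.^ k ⟧ * 2^- k) * 2^- m ≡⟨ cong (_* 2^- m) (2^*2^- k) ⟩
    1ℚ * 2^- m ≡⟨ *-identityˡ (2^- m) ⟩
    2^- m ∎
    where open ≡-Reasoning

  -- ⌊ y ⌋ for y ≥ 0, and junk value 0 for negative y
  floorℕ : ℚ → ℕ
  floorℕ (mkℚ (ℤ.+ a) b _) = a ℕ./ suc b
  floorℕ (mkℚ -[1+ _ ] _ _) = 0

  floorℕ-≈ : ∀ y → - 1ℚ ≤ y → ⟦ floorℕ y ⟧ ≈[ 1ℚ ] y
  floorℕ-≈ y@(mkℚ (ℤ.+ a) b _) _ =
    ≤-trans ⌊y⌋≤y (≤-trans (≤-reflexive (sym (+-identityʳ y))) (+-monoʳ-≤ y 0≤1)) ,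
    ≤-trans (<⇒≤ y<⌊y⌋+1) (≤-reflexive (+-comm 1ℚ ⟦ n ⟧))
    where
    n = a ℕ./ suc b
    ⌊y⌋≤y : ⟦ n ⟧ ≤ y
    ⌊y⌋≤y = subst (_≤ y) (sym (⟦⟧≡fromℤ n)) (*≤* (subst₂ ℤ._≤_ (ℤ.pos-* n (suc b)) (ℤ.pos-* a 1)
      (+≤+ (ℕ.≤-trans (ℕ.m/n*n≤m a (suc b)) (ℕ.≤-reflexive (sym (ℕ.*-identityʳ a)))))))
    y<⌊y⌋+1 : y < 1ℚ + ⟦ n ⟧
    y<⌊y⌋+1 = subst (y <_) (sym (⟦⟧≡fromℤ (suc n))) (*<* (subst₂ ℤ._<_ (ℤ.pos-* a 1) (ℤ.pos-* (suc n) (suc b))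
      (+<+ (ℕ.≤-trans (ℕ.≤-reflexive (cong suc (ℕ.*-identityʳ a)))
        (ℕ.≤-trans (ℕ.≤-reflexive (cong suc (ℕ.m≡m%n+[m/n]*n a (suc b))))
          (ℕ.+-monoˡ-≤ (n ℕ.* suc b) (ℕ.m%n<n a (suc b))))))))
  floorℕ-≈ y@(mkℚ -[1+ _ ] _ _) -1≤y =
    ≤-trans (≤-reflexive (sym (+-inverseˡ 1ℚ))) (+-monoˡ-≤ 1ℚ -1≤y) ,
    ≤-trans (*≤* ℤ.-≤+) 0≤1

  -- ε ≥ 1 / ↧ ε > 2^-(↧ ε)
  precision : ℚ → ℕ
  precision ε = 2 ℕ.+ ↧ₙ ε

  4*2^-precision≤ : ∀ ε → 0ℚ < ε → ⟦ 4 ⟧ * 2^- (precision ε) ≤ ε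
  4*2^-precision≤ ε@(mkℚ (ℤ.+ suc a) b _) 0<ε = begin
    ⟦ 4 ⟧ * 2^- (2 ℕ.+ d) ≡⟨ cong (⟦ 4 ⟧ *_) (2^-+ 2 d) ⟩
    ⟦ 4 ⟧ * (2^- 2 * 2^- d) ≡⟨ sym (*-assoc ⟦ 4 ⟧ (2^- 2) (2^- d)) ⟩
    1ℚ * 2^- d ≡⟨ *-identityˡ (2^- d) ⟩
    2^- d ≡⟨ sym (*-identityʳ (2^- d)) ⟩
    2^- d * 1ℚ ≤⟨ *-monoˡ-≤-nonNeg (2^- d) {{2^-nonNegative d}} 1≤2^d*ε ⟩
    2^- d * (⟦ 2 ℕ.^ d ⟧ * ε) ≡⟨ sym (*-assoc (2^- d) ⟦ 2 ℕ.^ d ⟧ ε) ⟩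
    (2^- d * ⟦ 2 ℕ.^ d ⟧) * ε ≡⟨ cong (_* ε) (2^-*2^ d) ⟩
    1ℚ * ε ≡⟨ *-identityˡ ε ⟩
    ε ∎
    where
    open ≤-Reasoning
    d = suc b
    1≤2^d*ε : 1ℚ ≤ ⟦ 2 ℕ.^ d ⟧ * ε
    1≤2^d*ε = begin
      1ℚ ≡⟨ sym (+-identityʳ 1ℚ) ⟩
      1ℚ + 0ℚ ≤⟨ +-monoʳ-≤ 1ℚ (⟦⟧-nonNeg a) ⟩
      ⟦ suc a ⟧ ≡⟨ sym (⟦⟧-*-/-cancel (suc a) b ε U.≃-refl) ⟩
      ⟦ d ⟧ * ε ≤⟨ *-monoʳ-≤-nonNeg ε {{nonNegative (<⇒≤ 0<ε)}} (⟦⟧-mono (NatApprox.n≤2^n d)) ⟩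
      ⟦ 2 ℕ.^ d ⟧ * ε ∎
  4*2^-precision≤ (mkℚ (ℤ.+ zero) _ _) (*<* (ℤ.+<+ ()))
  4*2^-precision≤ (mkℚ -[1+ _ ] _ _) (*<* ())

module RepresentationWeights where

  open import Defs
  open import Data.Rational
  open import Data.Rational.Properties
  open import Data.Rational.Solver
  open import Data.Bool using (true; false)
  open import Data.List using ([]; _∷_)
  open import Data.Nat using (ℕ; suc)
  import Data.Nat as ℕ
  import Data.Nat.Properties as ℕ
  open import Data.Product using (_,_; proj₁; proj₂)
  open import Data.Unit using (tt)
  import Data.Integer as ℤ
  open import Data.Rational.Unnormalised using (mkℚᵘ)
  open import Relation.Binary.PropositionalEquality
  open +-*-Solver using (solve; _:+_; _:*_; _:-_; :-_; _:=_; con)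
  open RationalApprox
  open NatApprox using () renaming (_≈[_]_ to _≈ℕ[_]_)

  -- approximates 2^k μ[τ]
  weight : Rep → ℕ → Str → ℕ
  weight f k τ = floorℕ (⟦ 2 ℕ.^ k ⟧ * f τ (k ℕ.+ 4))

  DistLt⇒≈ : ∀ x q r → DistLt x q r → ∀ m → seq x m ≈[ r + 2^- m ] q
  DistLt⇒≈ x q r (n , h) m =
    ≈-weaken error≤ (≈-trans (∣-∣≤⇒≈ (reg x m n)) (∣-∣≤⇒≈ {seq x n} {q} ≤-refl))
    where
    error≤ : 2^- m + 2^- n + ∣ seq x n - q ∣ ≤ r + 2^- m
    error≤ = begin
      2^- m + 2^- n + ∣ seq x n - q ∣
        ≡⟨ solve 3 (λ a b c → a :+ b :+ c := (c :+ b) :+ a) refl (2^- m) (2^- n) ∣ seq x n - q ∣ ⟩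
      (∣ seq x n - q ∣ + 2^- n) + 2^- m ≤⟨ +-monoˡ-≤ (2^- m) (<⇒≤ h) ⟩
      r + 2^- m ∎
      where open ≤-Reasoning

  DistLt-weaken : ∀ {x q r r'} → DistLt x q r → r ≤ r' → DistLt x q r'
  DistLt-weaken (n , h) r≤r' = n , <-≤-trans h r≤r'

  module _ {ν : Str → ℝ} (isμ : IsShiftInvProbMeasure ν) {f : Rep} (isR : IsRepresentation ν f) where

    open IsShiftInvProbMeasure isμ

    private
      ε : ℕ → ℚ
      ε k = 2^- (k ℕ.+ 4)

      q : ℕ → Str → ℚ
      q k τ = f τ (k ℕ.+ 4)

      Y : ℕ → Str → ℚ
      Y k τ = ⟦ 2 ℕ.^ k ⟧ * q k τ

    seq-≈-q : ∀ k τ m → seq (ν τ) m ≈[ ε k + 2^- m ] q k τ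
    seq-≈-q k τ m = DistLt⇒≈ (ν τ) (q k τ) (ε k) (isR τ (k ℕ.+ 4)) m

    Y≥-1 : ∀ k τ → - 1ℚ ≤ Y k τ
    Y≥-1 k τ = ≤-trans -1≤ (*-monoˡ-≤-nonNeg ⟦ 2 ℕ.^ k ⟧ {{⟦⟧-nonNegative (2 ℕ.^ k)}} q≥)
      where
      open ≤-Reasoning
      q≥ : - (ε k + ε k + ε k) ≤ q k τ
      q≥ = begin
        - (ε k + ε k + ε k) ≡⟨ solve 1 (λ a → :- (a :+ a :+ a) := :- a :- (a :+ a)) refl (ε k) ⟩
        - ε k - (ε k + ε k) ≤⟨ +-monoˡ-≤ (- (ε k + ε k)) (nonneg τ (k ℕ.+ 4)) ⟩
        seq (ν τ) (k ℕ.+ 4) - (ε k + ε k) ≤⟨ a≤b+e⇒a-e≤b (proj₁ (seq-≈-q k τ (k ℕ.+ 4))) ⟩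
        q k τ ∎
      -1≤ : - 1ℚ ≤ ⟦ 2 ℕ.^ k ⟧ * - (ε k + ε k + ε k)
      -1≤ = begin
        - 1ℚ ≤⟨ ≤ᵇ⇒≤ {p = - 1ℚ} {q = - (⟦ 3 ⟧ * 2^- 4)} tt ⟩
        - (⟦ 3 ⟧ * 2^- 4) ≡⟨ cong (λ z → - (⟦ 3 ⟧ * z)) (sym (2^*2^-+ k 4)) ⟩
        - (⟦ 3 ⟧ * (⟦ 2 ℕ.^ k ⟧ * ε k))
          ≡⟨ solve 2 (λ p a → :- (con ⟦ 3 ⟧ :* (p :* a)) := p :* (:- (a :+ a :+ a))) refl ⟦ 2 ℕ.^ k ⟧ (ε k) ⟩
        ⟦ 2 ℕ.^ k ⟧ * - (ε k + ε k + ε k) ∎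

    weight-≈ : ∀ k τ → ⟦ weight f k τ ⟧ ≈[ 1ℚ ] Y k τ
    weight-≈ k τ = floorℕ-≈ (Y k τ) (Y≥-1 k τ)

    q-additive : ∀ k x y z → x ≃ y ⊕ z → ∀ {qx qy qz} →
      (∀ m → seq x m ≈[ ε k + 2^- m ] qx) →
      (∀ m → seq y m ≈[ ε k + 2^- m ] qy) →
      (∀ m → seq z m ≈[ ε k + 2^- m ] qz) →
      qx ≈[ ⟦ 8 ⟧ * ε k ] qy + qz
    q-additive k x y z x≃y⊕z x≈ y≈ z≈ =
      ≈-weaken error≤ (≈-trans (≈-sym (x≈ i)) (≈-trans (∣-∣≤⇒≈ (x≃y⊕z i)) (≈-+ (y≈ (suc i)) (z≈ (suc i)))))
      where
      i = k ℕ.+ 4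
      error≤ : (ε k + 2^- i) + ((2^- i + 2^- i) + ((ε k + 2^- (suc i)) + (ε k + 2^- (suc i)))) ≤ ⟦ 8 ⟧ * ε k
      error≤ = begin
        (ε k + 2^- i) + ((2^- i + 2^- i) + ((ε k + 2^- (suc i)) + (ε k + 2^- (suc i))))
          ≤⟨ +-monoʳ-≤ (ε k + 2^- i) (+-monoʳ-≤ (2^- i + 2^- i)
               (+-mono-≤ (+-monoʳ-≤ (ε k) (2^-suc≤ i)) (+-monoʳ-≤ (ε k) (2^-suc≤ i)))) ⟩
        (ε k + ε k) + ((ε k + ε k) + ((ε k + ε k) + (ε k + ε k)))
          ≡⟨ solve 1 (λ a → (a :+ a) :+ ((a :+ a) :+ ((a :+ a) :+ (a :+ a))) := con ⟦ 8 ⟧ :* a) refl (ε k) ⟩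
        ⟦ 8 ⟧ * ε k ∎
        where open ≤-Reasoning

    weight-additive : ∀ k τ τ₁ τ₂ → ν τ ≃ ν τ₁ ⊕ ν τ₂ →
      weight f k τ ≈ℕ[ 4 ] weight f k τ₁ ℕ.+ weight f k τ₂
    weight-additive k τ τ₁ τ₂ ν≃ = ≈-⟦⟧⁻¹
      (≈-congʳ (sym (⟦⟧-+ (weight f k τ₁) (weight f k τ₂)))
        (≈-trans (weight-≈ k τ)
          (≈-trans (≈-congʳ (*-distribˡ-+ ⟦ 2 ℕ.^ k ⟧ (q k τ₁) (q k τ₂))
                      (≈-cong-error 2^k*8ε≡½ (≈-*ˡ ⟦ 2 ℕ.^ k ⟧ {{⟦⟧-nonNegative (2 ℕ.^ k)}}
                        (q-additive k (ν τ) (ν τ₁) (ν τ₂) ν≃ (seq-≈-q k τ) (seq-≈-q k τ₁) (seq-≈-q k τ₂)))))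
            (≈-+ (≈-sym (weight-≈ k τ₁)) (≈-sym (weight-≈ k τ₂))))))
      (≤ᵇ⇒≤ {1ℚ + (½ + (1ℚ + 1ℚ))} {⟦ 4 ⟧} tt)
      where
      2^k*8ε≡½ : ⟦ 2 ℕ.^ k ⟧ * (⟦ 8 ⟧ * ε k) ≡ ½
      2^k*8ε≡½ = trans (solve 3 (λ p c a → p :* (c :* a) := c :* (p :* a)) refl ⟦ 2 ℕ.^ k ⟧ ⟦ 8 ⟧ (ε k))
                   (cong (⟦ 8 ⟧ *_) (2^*2^-+ k 4))

    weight-additiveʳ : ∀ k τ → weight f k τ ≈ℕ[ 4 ] weight f k (snoc τ false) ℕ.+ weight f k (snoc τ true)
    weight-additiveʳ k τ = weight-additive k τ _ _ (additive τ)

    weight-additiveˡ : ∀ k τ → weight f k τ ≈ℕ[ 4 ] weight f k (false ∷ τ) ℕ.+ weight f k (true ∷ τ)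
    weight-additiveˡ k τ = weight-additive k τ _ _ (shiftInv τ)

    weight-[] : ∀ k → weight f k [] ≈ℕ[ 4 ] 2 ℕ.^ k
    weight-[] k = ≈-⟦⟧⁻¹
      (≈-congʳ (*-identityʳ ⟦ 2 ℕ.^ k ⟧)
        (≈-trans (weight-≈ k [])
          (≈-cong-error 2^k*4ε≡ (≈-*ˡ ⟦ 2 ℕ.^ k ⟧ {{⟦⟧-nonNegative (2 ℕ.^ k)}} (≈-trans (≈-sym (seq-≈-q k [] i)) (∣-∣≤⇒≈ (total i)))))))
      (≤ᵇ⇒≤ {1ℚ + ⟦ 4 ⟧ * 2^- 4} {⟦ 4 ⟧} tt)
      where
      i = k ℕ.+ 4
      2^k*4ε≡ : ⟦ 2 ℕ.^ k ⟧ * ((ε k + ε k) + (ε k + ε k)) ≡ ⟦ 4 ⟧ * 2^- 4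
      2^k*4ε≡ = trans (solve 2 (λ p a → p :* ((a :+ a) :+ (a :+ a)) := con ⟦ 4 ⟧ :* (p :* a)) refl ⟦ 2 ℕ.^ k ⟧ (ε k))
                  (cong (⟦ 4 ⟧ *_) (2^*2^-+ k 4))

    weight-rescale : ∀ K k σ → K ℕ.≤ k →
      2 ℕ.^ K ℕ.* weight f k σ ≈ℕ[ 4 ℕ.* 2 ℕ.^ k ] 2 ℕ.^ k ℕ.* weight f K σ
    weight-rescale K k σ K≤k = ≈-⟦⟧⁻¹
      (≈-congˡ (sym (⟦⟧-* (2 ℕ.^ K) (weight f k σ))) (≈-congʳ (sym (⟦⟧-* (2 ℕ.^ k) (weight f K σ)))
        (≈-trans (≈-*ˡ PK {{⟦⟧-nonNegative (2 ℕ.^ K)}} (weight-≈ k σ))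
          (≈-trans (≈-congˡ (*-assoc PK Pk (q k σ)) (≈-congʳ PKPk-q≡ (≈-cong-error PKPk-4ε≡
                     (≈-*ˡ (PK * Pk) {{PKPk-nonNegative}} q-≈))))
            (≈-*ˡ Pk {{⟦⟧-nonNegative (2 ℕ.^ k)}} (≈-sym (weight-≈ K σ)))))))
      error≤
      where
      PK = ⟦ 2 ℕ.^ K ⟧
      Pk = ⟦ 2 ℕ.^ k ⟧
      PKPk-nonNegative : NonNegative (PK * Pk)
      PKPk-nonNegative = nonNegative (≤-trans (≤-reflexive (sym (*-zeroˡ Pk)))
        (*-monoʳ-≤-nonNeg Pk {{⟦⟧-nonNegative (2 ℕ.^ k)}} (⟦⟧-nonNeg (2 ℕ.^ K))))
      q-≈ : q k σ ≈[ ⟦ 4 ⟧ * ε K ] q K σ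
      q-≈ = ≈-weaken (begin
          (ε k + ε K) + (ε K + ε K) ≤⟨ +-monoˡ-≤ (ε K + ε K) (+-monoˡ-≤ (ε K) (2^-antimono (ℕ.+-monoˡ-≤ 4 K≤k))) ⟩
          (ε K + ε K) + (ε K + ε K) ≡⟨ solve 1 (λ a → (a :+ a) :+ (a :+ a) := con ⟦ 4 ⟧ :* a) refl (ε K) ⟩
          ⟦ 4 ⟧ * ε K ∎)
        (≈-trans (≈-sym (seq-≈-q k σ (K ℕ.+ 4))) (seq-≈-q K σ (K ℕ.+ 4)))
        where open ≤-Reasoning
      PKPk-q≡ : PK * Pk * q K σ ≡ Pk * Y K σ
      PKPk-q≡ = solve 3 (λ a b q → a :* b :* q := b :* (a :* q)) refl PK Pk (q K σ)
      PKPk-4ε≡ : PK * Pk * (⟦ 4 ⟧ * ε K) ≡ Pk * (⟦ 4 ⟧ * 2^- 4)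
      PKPk-4ε≡ = trans (solve 4 (λ a b c x → a :* b :* (c :* x) := b :* (c :* (a :* x))) refl PK Pk ⟦ 4 ⟧ (ε K))
                   (cong (λ z → Pk * (⟦ 4 ⟧ * z)) (2^*2^-+ K 4))
      error≤ : PK * 1ℚ + (Pk * (⟦ 4 ⟧ * 2^- 4) + Pk * 1ℚ) ≤ ⟦ 4 ℕ.* 2 ℕ.^ k ⟧
      error≤ = begin
        PK * 1ℚ + (Pk * (⟦ 4 ⟧ * 2^- 4) + Pk * 1ℚ)
          ≤⟨ +-monoˡ-≤ (Pk * (⟦ 4 ⟧ * 2^- 4) + Pk * 1ℚ)
               (*-monoʳ-≤-nonNeg 1ℚ {{nonNegative 0≤1}} (⟦⟧-mono (ℕ.^-monoʳ-≤ 2 K≤k))) ⟩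
        Pk * 1ℚ + (Pk * (⟦ 4 ⟧ * 2^- 4) + Pk * 1ℚ)
          ≡⟨ solve 2 (λ p c → p :* con 1ℚ :+ (p :* c :+ p :* con 1ℚ) := p :* (con 1ℚ :+ c :+ con 1ℚ)) refl Pk (⟦ 4 ⟧ * 2^- 4) ⟩
        Pk * (1ℚ + ⟦ 4 ⟧ * 2^- 4 + 1ℚ)
          ≤⟨ *-monoˡ-≤-nonNeg Pk {{⟦⟧-nonNegative (2 ℕ.^ k)}} (≤ᵇ⇒≤ {1ℚ + ⟦ 4 ⟧ * 2^- 4 + 1ℚ} {⟦ 4 ⟧} tt) ⟩
        Pk * ⟦ 4 ⟧ ≡⟨ *-comm Pk ⟦ 4 ⟧ ⟩
        ⟦ 4 ⟧ * Pk ≡⟨ sym (⟦⟧-* 4 (2 ℕ.^ k)) ⟩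
        ⟦ 4 ℕ.* 2 ℕ.^ k ⟧ ∎
        where open ≤-Reasoning

    2^-*weight-≈ : ∀ K σ → 2^- K * ⟦ weight f K σ ⟧ ≈[ 2^- K ] q K σ
    2^-*weight-≈ K σ = ≈-cong-error (*-identityʳ (2^- K))
      (≈-congʳ 2^-K*Y≡q (≈-*ˡ (2^- K) {{2^-nonNegative K}} (weight-≈ K σ)))
      where
      2^-K*Y≡q : 2^- K * Y K σ ≡ q K σ
      2^-K*Y≡q = trans (sym (*-assoc (2^- K) ⟦ 2 ℕ.^ K ⟧ (q K σ)))
        (trans (cong (_* q K σ) (2^-*2^ K)) (*-identityˡ (q K σ)))

    frequency-DistLt : ∀ σ K L k C → L ℕ.≤ K →
      2 ℕ.^ L ℕ.* 2 ℕ.^ K ℕ.* C ≈ℕ[ 2 ℕ.* suc k ℕ.* 2 ℕ.^ K ] 2 ℕ.^ L ℕ.* suc k ℕ.* weight f K σ →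
      DistLt (ν σ) ((ℤ.+ C) / suc k) (⟦ 4 ⟧ * 2^- L)
    frequency-DistLt σ K L k C L≤K ≈ℕ = i , dist<
      where
      n = suc k
      X = weight f K σ
      a = (ℤ.+ C) / suc k
      PL = ⟦ 2 ℕ.^ L ⟧
      PK = ⟦ 2 ℕ.^ K ⟧
      r = 2^- L * 2^- K
      r-nonNegative : NonNegative r
      r-nonNegative = nonNegative (≤-trans (≤-reflexive (sym (*-zeroˡ (2^- K))))
        (*-monoʳ-≤-nonNeg (2^- K) {{2^-nonNegative K}} (<⇒≤ (2^-pos L))))
      ≈ℚ : PL * PK * ⟦ C ⟧ ≈[ ⟦ 2 ⟧ * ⟦ n ⟧ * PK ] PL * ⟦ n ⟧ * ⟦ X ⟧
      ≈ℚ = ≈-congˡ (trans (⟦⟧-* (2 ℕ.^ L ℕ.* 2 ℕ.^ K) C) (cong (_* ⟦ C ⟧) (⟦⟧-* (2 ℕ.^ L) (2 ℕ.^ K))))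
            (≈-congʳ (trans (⟦⟧-* (2 ℕ.^ L ℕ.* n) X) (cong (_* ⟦ X ⟧) (⟦⟧-* (2 ℕ.^ L) n)))
            (≈-cong-error (trans (⟦⟧-* (2 ℕ.* n) (2 ℕ.^ K)) (cong (_* PK) (⟦⟧-* 2 n)))
            (≈-⟦⟧ ≈ℕ)))
      scaled : ⟦ n ⟧ * a ≈[ ⟦ n ⟧ * (⟦ 2 ⟧ * 2^- L) ] ⟦ n ⟧ * (2^- K * ⟦ X ⟧)
      scaled = ≈-congˡ lhs≡ (≈-congʳ rhs≡ (≈-cong-error error≡ (≈-*ˡ r {{r-nonNegative}} ≈ℚ)))
        where
        lhs≡ : r * (PL * PK * ⟦ C ⟧) ≡ ⟦ n ⟧ * a
        lhs≡ = trans (solve 5 (λ a b c d x → (a :* b) :* (c :* d :* x) := (a :* c) :* (b :* d) :* x) refl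
                      (2^- L) (2^- K) PL PK ⟦ C ⟧)
                (trans (cong₂ (λ u v → u * v * ⟦ C ⟧) (2^-*2^ L) (2^-*2^ K))
                (trans (solve 1 (λ x → con 1ℚ :* con 1ℚ :* x := x) refl ⟦ C ⟧)
                       (sym (⟦⟧-*-/-cancel C k a (toℚᵘ-fromℚᵘ (mkℚᵘ (ℤ.+ C) k))))))
        rhs≡ : r * (PL * ⟦ n ⟧ * ⟦ X ⟧) ≡ ⟦ n ⟧ * (2^- K * ⟦ X ⟧)
        rhs≡ = trans (solve 5 (λ a b c m x → (a :* b) :* (c :* m :* x) := (a :* c) :* (m :* (b :* x))) refl
                      (2^- L) (2^- K) PL ⟦ n ⟧ ⟦ X ⟧)
                (trans (cong (_* (⟦ n ⟧ * (2^- K * ⟦ X ⟧))) (2^-*2^ L)) (*-identityˡ _))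
        error≡ : r * (⟦ 2 ⟧ * ⟦ n ⟧ * PK) ≡ ⟦ n ⟧ * (⟦ 2 ⟧ * 2^- L)
        error≡ = trans (solve 5 (λ a b t m p → (a :* b) :* (t :* m :* p) := m :* (t :* a) :* (b :* p)) refl
                      (2^- L) (2^- K) ⟦ 2 ⟧ ⟦ n ⟧ PK)
                (trans (cong (⟦ n ⟧ * (⟦ 2 ⟧ * 2^- L) *_) (2^-*2^ K)) (*-identityʳ _))
      q-≈-a : q K σ ≈[ 2^- K + ⟦ 2 ⟧ * 2^- L ] a
      q-≈-a = ≈-trans (≈-sym (2^-*weight-≈ K σ)) (≈-sym (≈-cancel-*ˡ ⟦ n ⟧ {{⟦suc⟧-positive k}} scaled))
      i = proj₁ (isR σ (K ℕ.+ 4))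
      x = seq (ν σ) i
      dist≤ : ∣ x - a ∣ ≤ ∣ x - q K σ ∣ + (2^- K + ⟦ 2 ⟧ * 2^- L)
      dist≤ = ≈⇒∣-∣≤ (≈-trans (∣-∣≤⇒≈ {x} {q K σ} ≤-refl) q-≈-a)
      dist< : ∣ x - a ∣ + 2^- i < ⟦ 4 ⟧ * 2^- L
      dist< = begin-strict
        ∣ x - a ∣ + 2^- i ≤⟨ +-monoˡ-≤ (2^- i) dist≤ ⟩
        ∣ x - q K σ ∣ + (2^- K + ⟦ 2 ⟧ * 2^- L) + 2^- i
          ≡⟨ solve 4 (λ u v w z → u :+ (v :+ w) :+ z := (u :+ z) :+ (v :+ w)) refl ∣ x - q K σ ∣ (2^- K) (⟦ 2 ⟧ * 2^- L) (2^- i) ⟩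
        (∣ x - q K σ ∣ + 2^- i) + (2^- K + ⟦ 2 ⟧ * 2^- L) <⟨ +-monoˡ-< (2^- K + ⟦ 2 ⟧ * 2^- L) (proj₂ (isR σ (K ℕ.+ 4))) ⟩
        ε K + (2^- K + ⟦ 2 ⟧ * 2^- L)
          ≤⟨ +-mono-≤ (2^-antimono (ℕ.≤-trans L≤K (ℕ.m≤m+n K 4))) (+-monoˡ-≤ (⟦ 2 ⟧ * 2^- L) (2^-antimono L≤K)) ⟩
        2^- L + (2^- L + ⟦ 2 ⟧ * 2^- L) ≡⟨ solve 1 (λ z → z :+ (z :+ con ⟦ 2 ⟧ :* z) := con ⟦ 4 ⟧ :* z) refl (2^- L) ⟩
        ⟦ 4 ⟧ * 2^- L ∎
        where open ≤-Reasoning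


module Windows where

  open import Defs
  open import Data.Bool using (Bool; true; false; _∧_; if_then_else_)
  open import Data.List using ([]; _∷_; length; _++_)
  open import Data.List.Properties using (length-++)
  open import Data.Nat
  open import Data.Nat.Properties
  open import Data.Product using (_,_)
  open import Relation.Binary.PropositionalEquality
  open import Relation.Nullary using (yes; no)
  open ≡-Reasoning
  open NatApprox using (_≤_≤+_)

  infixr 5 _++ᵖ_
  _++ᵖ_ : Str → Point → Point
  ([] ++ᵖ ω) k = ω k
  ((b ∷ τ) ++ᵖ ω) zero = b
  ((b ∷ τ) ++ᵖ ω) (suc k) = (τ ++ᵖ ω) k

  zeros : Point
  zeros _ = false

  indicator : Bool → ℕ
  indicator b = if b then 1 else 0

  indicator≤1 : ∀ b → indicator b ≤ 1
  indicator≤1 true = ≤-refl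
  indicator≤1 false = z≤n

  inCyl-cong : ∀ σ {ω ω'} → ω ≗ ω' → inCyl σ ω ≡ inCyl σ ω'
  inCyl-cong [] e = refl
  inCyl-cong (b ∷ σ) e = cong₂ (λ x y → eqB b x ∧ y) (e 0) (inCyl-cong σ (λ k → e (suc k)))

  count-cong : ∀ σ {ω ω'} → ω ≗ ω' → ∀ n → count σ ω n ≡ count σ ω' n
  count-cong σ e zero = refl
  count-cong σ e (suc n) = cong₂ _+_ (count-cong σ e n) (cong indicator (inCyl-cong σ (λ k → e (n + k))))

  count≤n : ∀ σ ω n → count σ ω n ≤ n
  count≤n σ ω zero = z≤n
  count≤n σ ω (suc n) = ≤-trans (+-mono-≤ (count≤n σ ω n) (indicator≤1 (inCyl σ (shift n ω))))
    (≤-reflexive (+-comm n 1))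

  count-+ : ∀ σ ω a b → count σ ω (a + b) ≡ count σ ω a + count σ (shift a ω) b
  count-+ σ ω a zero = trans (cong (count σ ω) (+-identityʳ a)) (sym (+-identityʳ _))
  count-+ σ ω a (suc b) = begin
    count σ ω (a + suc b) ≡⟨ cong (count σ ω) (+-suc a b) ⟩
    count σ ω (a + b) + indicator (inCyl σ (shift (a + b) ω))
      ≡⟨ cong₂ _+_ (count-+ σ ω a b) (cong indicator (inCyl-cong σ (λ k → cong ω (+-assoc a b k)))) ⟩
    (count σ ω a + count σ (shift a ω) b) + indicator (inCyl σ (shift b (shift a ω)))
      ≡⟨ +-assoc (count σ ω a) _ _ ⟩
    count σ ω a + count σ (shift a ω) (suc b) ∎

  count-extend : ∀ σ ω n d → count σ ω n ≤ count σ ω (n + d) ≤+ d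
  count-extend σ ω n d rewrite count-+ σ ω n d =
    m≤m+n _ _ , +-monoʳ-≤ (count σ ω n) (count≤n σ (shift n ω) d)

  shift-++ᵖ : ∀ τ ω → shift (length τ) (τ ++ᵖ ω) ≗ ω
  shift-++ᵖ [] ω k = refl
  shift-++ᵖ (b ∷ τ) ω k = shift-++ᵖ τ ω k

  ++ᵖ-assoc : ∀ xs ys ω → (xs ++ ys) ++ᵖ ω ≗ xs ++ᵖ (ys ++ᵖ ω)
  ++ᵖ-assoc [] ys ω k = refl
  ++ᵖ-assoc (x ∷ xs) ys ω zero = refl
  ++ᵖ-assoc (x ∷ xs) ys ω (suc k) = ++ᵖ-assoc xs ys ω k

  count-++ : ∀ σ xs ys ω → count σ ((xs ++ ys) ++ᵖ ω) (length (xs ++ ys))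
    ≡ count σ (xs ++ᵖ (ys ++ᵖ ω)) (length xs) + count σ (ys ++ᵖ ω) (length ys)
  count-++ σ xs ys ω = begin
    count σ ((xs ++ ys) ++ᵖ ω) (length (xs ++ ys))
      ≡⟨ cong (count σ ((xs ++ ys) ++ᵖ ω)) (length-++ xs) ⟩
    count σ ((xs ++ ys) ++ᵖ ω) (length xs + length ys)
      ≡⟨ count-cong σ (++ᵖ-assoc xs ys ω) (length xs + length ys) ⟩
    count σ (xs ++ᵖ (ys ++ᵖ ω)) (length xs + length ys)
      ≡⟨ count-+ σ _ (length xs) (length ys) ⟩
    count σ (xs ++ᵖ (ys ++ᵖ ω)) (length xs) + count σ (shift (length xs) (xs ++ᵖ (ys ++ᵖ ω))) (length ys)
      ≡⟨ cong (count σ (xs ++ᵖ (ys ++ᵖ ω)) (length xs) +_) (count-cong σ (shift-++ᵖ xs (ys ++ᵖ ω)) (length ys)) ⟩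
    count σ (xs ++ᵖ (ys ++ᵖ ω)) (length xs) + count σ (ys ++ᵖ ω) (length ys) ∎

  inCyl-prefix : ∀ σ τ ω ω' → length σ ≤ length τ → inCyl σ (τ ++ᵖ ω) ≡ inCyl σ (τ ++ᵖ ω')
  inCyl-prefix [] τ ω ω' le = refl
  inCyl-prefix (s ∷ σ) (b ∷ τ) ω ω' (s≤s le) = cong (eqB s b ∧_) (inCyl-prefix σ τ ω ω' le)

  inCyl-shift-prefix : ∀ σ τ ω ω' i → i + length σ ≤ length τ →
    inCyl σ (shift i (τ ++ᵖ ω)) ≡ inCyl σ (shift i (τ ++ᵖ ω'))
  inCyl-shift-prefix σ τ ω ω' zero le = inCyl-prefix σ τ ω ω' le
  inCyl-shift-prefix σ (b ∷ τ) ω ω' (suc i) (s≤s le) = inCyl-shift-prefix σ τ ω ω' i le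

  count-prefix : ∀ σ τ ω ω' n → n + length σ ≤ length τ →
    count σ (τ ++ᵖ ω) n ≡ count σ (τ ++ᵖ ω') n
  count-prefix σ τ ω ω' zero le = refl
  count-prefix σ τ ω ω' (suc n) le =
    cong₂ _+_ (count-prefix σ τ ω ω' n (≤-trans (n≤1+n _) le))
      (cong indicator (inCyl-shift-prefix σ τ ω ω' n (≤-trans (n≤1+n _) le)))

  -- occurrences of σ lying entirely inside τ
  occurrences : Str → Str → ℕ
  occurrences σ τ = count σ (τ ++ᵖ zeros) (length τ ∸ length σ)

  count-++ᵖ-occurrences : ∀ σ τ ω → occurrences σ τ ≤ count σ (τ ++ᵖ ω) (length τ) ≤+ length σ
  count-++ᵖ-occurrences σ τ ω with length σ ≤? length τ
  ... | yes σ≤τ = subst (λ z → occurrences σ τ ≤ count σ (τ ++ᵖ ω) z ≤+ length σ) (m∸n+n≡m σ≤τ)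
          (subst (λ c → c ≤ count σ (τ ++ᵖ ω) (n + length σ) ≤+ length σ)
             (count-prefix σ τ ω zeros n (≤-reflexive (m∸n+n≡m σ≤τ)))
             (count-extend σ (τ ++ᵖ ω) n (length σ)))
    where n = length τ ∸ length σ
  ... | no σ≰τ rewrite m≤n⇒m∸n≡0 (<⇒≤ (≰⇒> σ≰τ)) =
    z≤n , ≤-trans (count≤n σ _ (length τ)) (<⇒≤ (≰⇒> σ≰τ))

module WordSums where

  open import Defs
  open import Data.Bool using (true; false)
  open import Data.List using (List; []; _∷_; length; map; _++_)
  open import Data.List.Properties using (length-++; length-map)
  open import Data.List.Relation.Unary.All as All using (All; []; _∷_)
  import Data.List.Relation.Unary.All.Properties as All
  open import Data.Nat
  open import Data.Nat.Properties
  open import Data.Product using (_,_; proj₁; proj₂)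
  open import Algebra.Properties.CommutativeSemigroup +-commutativeSemigroup using (interchange)
  open import Relation.Binary.PropositionalEquality
  open ≡-Reasoning
  open NatApprox
  open Windows

  ∑ : {A : Set} → List A → (A → ℕ) → ℕ
  ∑ [] f = 0
  ∑ (x ∷ xs) f = f x + ∑ xs f

  module _ {A : Set} where

    ∑-++ : ∀ (xs ys : List A) f → ∑ (xs ++ ys) f ≡ ∑ xs f + ∑ ys f
    ∑-++ [] ys f = refl
    ∑-++ (x ∷ xs) ys f = trans (cong (f x +_) (∑-++ xs ys f)) (sym (+-assoc (f x) _ _))

    ∑-cong : ∀ (xs : List A) {f g} → (∀ x → f x ≡ g x) → ∑ xs f ≡ ∑ xs g
    ∑-cong [] e = refl
    ∑-cong (x ∷ xs) e = cong₂ _+_ (e x) (∑-cong xs e)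

    ∑-+ : ∀ (xs : List A) f g → ∑ xs (λ x → f x + g x) ≡ ∑ xs f + ∑ xs g
    ∑-+ [] f g = refl
    ∑-+ (x ∷ xs) f g rewrite ∑-+ xs f g = interchange (f x) (g x) (∑ xs f) (∑ xs g)

    ∑-zero : ∀ (xs : List A) → ∑ xs (λ _ → 0) ≡ 0
    ∑-zero [] = refl
    ∑-zero (x ∷ xs) = ∑-zero xs

    ∑-≤+ : ∀ (xs : List A) {f g} c → (∀ x → f x ≤ g x + c) → ∑ xs f ≤ ∑ xs g + length xs * c
    ∑-≤+ [] c e = z≤n
    ∑-≤+ (x ∷ xs) {f} {g} c e = ≤-trans (+-mono-≤ (e x) (∑-≤+ xs c e))
      (≤-reflexive (interchange (g x) c (∑ xs g) (length xs * c)))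

    ∑-*zero : ∀ (xs : List A) (f : A → ℕ) → ∑ xs (λ x → f x * 0) ≡ 0
    ∑-*zero xs f = trans (∑-cong xs {λ x → f x * 0} (λ x → *-zeroʳ (f x))) (∑-zero xs)

    ∑-≈ : ∀ (xs : List A) {f g} c → (∀ x → f x ≈[ c ] g x) → ∑ xs f ≈[ length xs * c ] ∑ xs g
    ∑-≈ xs c e = ∑-≤+ xs c (λ x → proj₁ (e x)) , ∑-≤+ xs c (λ x → proj₂ (e x))

  ∑< : ℕ → (ℕ → ℕ) → ℕ
  ∑< zero f = 0
  ∑< (suc n) f = ∑< n f + f n

  ∑<-≈ : ∀ n f e G → (∀ p → p < n → f p ≈[ e ] G) → ∑< n f ≈[ n * e ] n * G
  ∑<-≈ zero f e G h = z≤n , z≤n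
  ∑<-≈ (suc n) f e G h =
    ≈-cong-error (+-comm (n * e) e) (≈-congʳ (+-comm (n * G) G)
      (≈-+ (∑<-≈ n f e G (λ p p<n → h p (≤-trans p<n (n≤1+n n)))) (h n ≤-refl)))

  ∑-map : ∀ {A B : Set} (h : A → B) (xs : List A) f → ∑ (map h xs) f ≡ ∑ xs (λ x → f (h x))
  ∑-map h [] f = refl
  ∑-map h (x ∷ xs) f = cong (f (h x) +_) (∑-map h xs f)

  words : ℕ → List Str
  words zero = [] ∷ []
  words (suc n) = map (false ∷_) (words n) ++ map (true ∷_) (words n)

  length-words : ∀ n → length (words n) ≡ 2 ^ n
  length-words zero = refl
  length-words (suc n) = begin
    length (map (false ∷_) (words n) ++ map (true ∷_) (words n))
      ≡⟨ length-++ (map (false ∷_) (words n)) ⟩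
    length (map (false ∷_) (words n)) + length (map (true ∷_) (words n))
      ≡⟨ cong₂ _+_ (length-map _ (words n)) (length-map _ (words n)) ⟩
    length (words n) + length (words n) ≡⟨ cong₂ _+_ (length-words n) (length-words n) ⟩
    2 ^ n + 2 ^ n ≡⟨ cong (2 ^ n +_) (sym (+-identityʳ (2 ^ n))) ⟩
    2 ^ suc n ∎

  words-length : ∀ n → All (λ τ → length τ ≡ n) (words n)
  words-length zero = refl ∷ []
  words-length (suc n) = All.++⁺ (All.map⁺ (All.map (cong suc) (words-length n)))
                                 (All.map⁺ (All.map (cong suc) (words-length n)))

  ∑-words-suc : ∀ n f → ∑ (words (suc n)) f ≡ ∑ (words n) (λ τ → f (false ∷ τ)) + ∑ (words n) (λ τ → f (true ∷ τ))
  ∑-words-suc n f = trans (∑-++ (map (false ∷_) (words n)) _ f)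
    (cong₂ _+_ (∑-map (false ∷_) (words n) f) (∑-map (true ∷_) (words n) f))

  -- Summing over all τ of length p + |σ| + r the weight of those τ in which σ occurs at
  -- position p is summing over all decompositions τ = α σ β.
  ∑-occurrence-at₀ : ∀ σ r (a : Str → ℕ) ω →
    ∑ (words (length σ + r)) (λ τ → a τ * indicator (inCyl σ (τ ++ᵖ ω))) ≡ ∑ (words r) (λ β → a (σ ++ β))
  ∑-occurrence-at₀ [] r a ω = ∑-cong (words r) (λ τ → *-identityʳ (a τ))
  ∑-occurrence-at₀ (false ∷ σ) r a ω = begin
    ∑ (words (suc (length σ + r))) (λ τ → a τ * indicator (inCyl (false ∷ σ) (τ ++ᵖ ω)))
      ≡⟨ ∑-words-suc (length σ + r) _ ⟩
    ∑ (words (length σ + r)) (λ τ → a (false ∷ τ) * indicator (inCyl σ (τ ++ᵖ ω)))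
     + ∑ (words (length σ + r)) (λ τ → a (true ∷ τ) * 0)
      ≡⟨ cong₂ _+_ (∑-occurrence-at₀ σ r (λ τ → a (false ∷ τ)) ω) (∑-*zero (words (length σ + r)) (λ τ → a (true ∷ τ))) ⟩
    ∑ (words r) (λ β → a (false ∷ σ ++ β)) + 0 ≡⟨ +-identityʳ _ ⟩
    ∑ (words r) (λ β → a (false ∷ σ ++ β)) ∎
  ∑-occurrence-at₀ (true ∷ σ) r a ω = begin
    ∑ (words (suc (length σ + r))) (λ τ → a τ * indicator (inCyl (true ∷ σ) (τ ++ᵖ ω)))
      ≡⟨ ∑-words-suc (length σ + r) _ ⟩
    ∑ (words (length σ + r)) (λ τ → a (false ∷ τ) * 0)
     + ∑ (words (length σ + r)) (λ τ → a (true ∷ τ) * indicator (inCyl σ (τ ++ᵖ ω)))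
      ≡⟨ cong₂ _+_ (∑-*zero (words (length σ + r)) (λ τ → a (false ∷ τ))) (∑-occurrence-at₀ σ r (λ τ → a (true ∷ τ)) ω) ⟩
    ∑ (words r) (λ β → a (true ∷ σ ++ β)) ∎

  ∑-occurrence-at : ∀ p σ r (a : Str → ℕ) ω →
    ∑ (words (p + (length σ + r))) (λ τ → a τ * indicator (inCyl σ (shift p (τ ++ᵖ ω))))
      ≡ ∑ (words p) (λ α → ∑ (words r) (λ β → a (α ++ σ ++ β)))
  ∑-occurrence-at zero σ r a ω = trans (∑-occurrence-at₀ σ r a ω) (sym (+-identityʳ _))
  ∑-occurrence-at (suc p) σ r a ω = begin
    ∑ (words (suc (p + (length σ + r)))) (λ τ → a τ * indicator (inCyl σ (shift (suc p) (τ ++ᵖ ω))))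
      ≡⟨ ∑-words-suc (p + (length σ + r)) _ ⟩
    ∑ (words (p + (length σ + r))) (λ τ → a (false ∷ τ) * indicator (inCyl σ (shift p (τ ++ᵖ ω))))
     + ∑ (words (p + (length σ + r))) (λ τ → a (true ∷ τ) * indicator (inCyl σ (shift p (τ ++ᵖ ω))))
      ≡⟨ cong₂ _+_ (∑-occurrence-at p σ r (λ τ → a (false ∷ τ)) ω) (∑-occurrence-at p σ r (λ τ → a (true ∷ τ)) ω) ⟩
    ∑ (words p) (λ α → ∑ (words r) (λ β → a (false ∷ α ++ σ ++ β)))
     + ∑ (words p) (λ α → ∑ (words r) (λ β → a (true ∷ α ++ σ ++ β)))
      ≡⟨ sym (∑-words-suc p (λ α → ∑ (words r) (λ β → a (α ++ σ ++ β)))) ⟩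
    ∑ (words (suc p)) (λ α → ∑ (words r) (λ β → a (α ++ σ ++ β))) ∎

module Blocks where

  open import Defs
  open import Data.List using (List; []; _∷_; length; _++_; concat; concatMap; replicate)
  open import Data.List.Properties using (length-++)
  open import Data.List.Relation.Unary.All using (All; []; _∷_)
  open import Data.Nat
  open import Data.Nat.Properties
  open import Data.Product using (_,_)
  open import Relation.Binary.PropositionalEquality
  open ≡-Reasoning
  open NatApprox
  open Windows
  open WordSums

  copies : ℕ → Str → Str
  copies n τ = concat (replicate n τ)

  block : List Str → (Str → ℕ) → Str
  block ts a = concatMap (λ τ → copies (a τ) τ) ts

  length-copies : ∀ n τ → length (copies n τ) ≡ n * length τ
  length-copies zero τ = refl
  length-copies (suc n) τ = trans (length-++ τ) (cong (length τ +_) (length-copies n τ))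

  length-block : ∀ J ts a → All (λ τ → length τ ≡ J) ts → length (block ts a) ≡ J * ∑ ts a
  length-block J [] a [] = sym (*-zeroʳ J)
  length-block J (τ ∷ ts) a (|τ|≡J ∷ all) = begin
    length (copies (a τ) τ ++ block ts a) ≡⟨ length-++ (copies (a τ) τ) ⟩
    length (copies (a τ) τ) + length (block ts a) ≡⟨ cong₂ _+_ (length-copies (a τ) τ) (length-block J ts a all) ⟩
    a τ * length τ + J * ∑ ts a ≡⟨ cong (λ z → a τ * z + J * ∑ ts a) |τ|≡J ⟩
    a τ * J + J * ∑ ts a ≡⟨ cong (_+ J * ∑ ts a) (*-comm (a τ) J) ⟩
    J * a τ + J * ∑ ts a ≡⟨ sym (*-distribˡ-+ J (a τ) _) ⟩
    J * ∑ (τ ∷ ts) a ∎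

  count-copies : ∀ σ n τ ω →
    n * occurrences σ τ ≤ count σ (copies n τ ++ᵖ ω) (length (copies n τ)) ≤+ n * length σ
  count-copies σ zero τ ω = z≤n , z≤n
  count-copies σ (suc n) τ ω rewrite count-++ σ τ (copies n τ) ω =
    ≤≤+-+ (count-++ᵖ-occurrences σ τ (copies n τ ++ᵖ ω)) (count-copies σ n τ ω)

  -- only windows straddling two consecutive copies escape the count of occurrences
  count-block : ∀ σ ts a ω →
    ∑ ts (λ τ → a τ * occurrences σ τ) ≤ count σ (block ts a ++ᵖ ω) (length (block ts a)) ≤+ ∑ ts a * length σ
  count-block σ [] a ω = z≤n , z≤n
  count-block σ (τ ∷ ts) a ω rewrite count-++ σ (copies (a τ) τ) (block ts a) ω
    | *-distribʳ-+ (length σ) (a τ) (∑ ts a) =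
    ≤≤+-+ (count-copies σ (a τ) τ (block ts a ++ᵖ ω)) (count-block σ ts a ω)

  weightAt : Str → (Str → ℕ) → List Str → ℕ → ℕ
  weightAt σ a ts p = ∑ ts (λ τ → a τ * indicator (inCyl σ (shift p (τ ++ᵖ zeros))))

  ∑-count : ∀ σ a ts n → ∑ ts (λ τ → a τ * count σ (τ ++ᵖ zeros) n) ≡ ∑< n (weightAt σ a ts)
  ∑-count σ a ts zero = ∑-*zero ts a
  ∑-count σ a ts (suc n) = begin
    ∑ ts (λ τ → a τ * (count σ (τ ++ᵖ zeros) n + indicator (inCyl σ (shift n (τ ++ᵖ zeros)))))
      ≡⟨ ∑-cong ts (λ τ → *-distribˡ-+ (a τ) _ _) ⟩
    ∑ ts (λ τ → a τ * count σ (τ ++ᵖ zeros) n + a τ * indicator (inCyl σ (shift n (τ ++ᵖ zeros))))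
      ≡⟨ ∑-+ ts _ _ ⟩
    ∑ ts (λ τ → a τ * count σ (τ ++ᵖ zeros) n) + weightAt σ a ts n
      ≡⟨ cong (_+ weightAt σ a ts n) (∑-count σ a ts n) ⟩
    ∑< (suc n) (weightAt σ a ts) ∎

  ∑-occurrences : ∀ σ a J →
    ∑ (words J) (λ τ → a τ * occurrences σ τ) ≡ ∑< (J ∸ length σ) (weightAt σ a (words J))
  ∑-occurrences σ a J = trans (lengths-fixed (words J) (words-length J)) (∑-count σ a (words J) (J ∸ length σ))
    where
    lengths-fixed : ∀ ts → All (λ τ → length τ ≡ J) ts →
      ∑ ts (λ τ → a τ * occurrences σ τ) ≡ ∑ ts (λ τ → a τ * count σ (τ ++ᵖ zeros) (J ∸ length σ))
    lengths-fixed [] [] = refl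
    lengths-fixed (τ ∷ ts) (|τ|≡J ∷ all) =
      cong₂ _+_ (cong (λ z → a τ * count σ (τ ++ᵖ zeros) (z ∸ length σ)) |τ|≡J) (lengths-fixed ts all)

module AlmostAdditivity where

  open import Defs
  open import Data.Bool using (true; false)
  open import Data.List using (List; []; _∷_; length; _++_)
  open import Data.List.Properties using (++-assoc; ++-identityʳ)
  open import Data.List.Membership.Propositional using (_∈_)
  open import Data.List.Membership.Propositional.Properties using (∈-map⁺; ∈-++⁺ˡ; ∈-++⁺ʳ)
  open import Data.List.Relation.Unary.Any using (here; there)
  open import Data.Nat
  open import Data.Nat.Properties
  open import Data.Product using (proj₁)
  open import Relation.Binary.PropositionalEquality
  open import Data.Nat.Tactic.RingSolver using (solve-∀)
  open import Algebra.Properties.CommutativeSemigroup +-commutativeSemigroup using (x∙yz≈y∙xz)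
  open NatApprox
  open Windows
  open WordSums
  open Blocks

  ∑-term : ∀ {A : Set} {x : A} {xs} (f : A → ℕ) → x ∈ xs → f x ≤ ∑ xs f
  ∑-term f (here refl) = m≤m+n _ _
  ∑-term {x = x} {y ∷ xs} f (there x∈xs) = ≤-trans (∑-term f x∈xs) (m≤n+m _ (f y))

  ∈-words : ∀ σ → σ ∈ words (length σ)
  ∈-words [] = here refl
  ∈-words (false ∷ σ) = ∈-++⁺ˡ (∈-map⁺ (false ∷_) (∈-words σ))
  ∈-words (true ∷ σ) = ∈-++⁺ʳ _ (∈-map⁺ (true ∷_) (∈-words σ))

  snoc-++ : ∀ γ b β → γ ++ (b ∷ β) ≡ snoc γ b ++ β
  snoc-++ [] b β = refl
  snoc-++ (x ∷ γ) b β = cong (x ∷_) (snoc-++ γ b β)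

  -- Integer weights on words that are additive, up to an error c, under extension on the right
  -- and on the left: the discrete shadow of a shift-invariant measure.
  module Weights (g : Str → ℕ) (c : ℕ)
    (additiveʳ : ∀ τ → g τ ≈[ c ] g (snoc τ false) + g (snoc τ true))
    (additiveˡ : ∀ τ → g τ ≈[ c ] g (false ∷ τ) + g (true ∷ τ)) where

    extensionError : ℕ → ℕ
    extensionError zero = 0
    extensionError (suc r) = (extensionError r + extensionError r) + c

    extensionError-bound : ∀ r → extensionError r + c ≤ c * 2 ^ r
    extensionError-bound zero = ≤-reflexive (sym (*-identityʳ c))
    extensionError-bound (suc r) = ≤-trans (≤-reflexive (lem (extensionError r) c))
      (≤-trans (+-mono-≤ (extensionError-bound r) (extensionError-bound r)) (≤-reflexive (lem2 c (2 ^ r))))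
      where
      lem : ∀ a c → (a + a + c) + c ≡ (a + c) + (a + c)
      lem = solve-∀
      lem2 : ∀ c x → c * x + c * x ≡ c * (2 * x)
      lem2 = solve-∀

    ∑-extensions : ∀ r γ → ∑ (words r) (λ β → g (γ ++ β)) ≈[ extensionError r ] g γ
    ∑-extensions zero γ = ≈-congˡ (trans (cong g (sym (++-identityʳ γ))) (sym (+-identityʳ _))) ≈-refl
    ∑-extensions (suc r) γ =
      ≈-congˡ (sym (trans (∑-words-suc r (λ β → g (γ ++ β)))
            (cong₂ _+_ (∑-cong (words r) (λ β → cong g (snoc-++ γ false β)))
                       (∑-cong (words r) (λ β → cong g (snoc-++ γ true β))))))
        (≈-trans (≈-+ (∑-extensions r (snoc γ false)) (∑-extensions r (snoc γ true))) (≈-sym (additiveʳ γ)))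

    prefixError : ℕ → ℕ
    prefixError zero = 0
    prefixError (suc p) = 2 ^ p * c + prefixError p

    prefixError-bound : ∀ p → prefixError p + c ≤ c * 2 ^ p
    prefixError-bound zero = ≤-reflexive (sym (*-identityʳ c))
    prefixError-bound (suc p) = ≤-trans (≤-reflexive (+-assoc (2 ^ p * c) (prefixError p) c))
      (≤-trans (+-monoʳ-≤ (2 ^ p * c) (prefixError-bound p)) (≤-reflexive (lem c (2 ^ p))))
      where
      lem : ∀ c x → x * c + c * x ≡ c * (2 * x)
      lem = solve-∀

    ∑-prefixes : ∀ p δ → ∑ (words p) (λ α → g (α ++ δ)) ≈[ prefixError p ] g δ
    ∑-prefixes zero δ = ≈-congˡ (sym (+-identityʳ _)) ≈-refl
    ∑-prefixes (suc p) δ =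
      ≈-congˡ (sym (trans (∑-words-suc p (λ α → g (α ++ δ))) (sym (∑-+ (words p) _ _))))
        (≈-trans (≈-cong-error (cong (_* c) (length-words p))
                   (∑-≈ (words p) c (λ α → ≈-sym (additiveˡ (α ++ δ)))))
                 (∑-prefixes p δ))

    g≤g[] : ∀ σ → g σ ≤ g [] + c * 2 ^ length σ
    g≤g[] σ = ≤-trans (∑-term g (∈-words σ))
      (≤-trans (proj₁ (∑-extensions (length σ) [])) (+-monoʳ-≤ (g []) (≤-trans (m≤m+n _ c) (extensionError-bound (length σ)))))

    weightAt-≈ : ∀ p r σ →
      ∑ (words (p + (length σ + r))) (λ τ → g τ * indicator (inCyl σ (shift p (τ ++ᵖ zeros))))
        ≈[ 2 ^ p * extensionError r + prefixError p ] g σ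
    weightAt-≈ p r σ = ≈-congˡ (sym (∑-occurrence-at p σ r g zeros))
      (≈-trans (≈-cong-error (cong (_* extensionError r) (length-words p))
         (∑-≈ (words p) (extensionError r) (λ α → ≈-congˡ (∑-cong (words r) (λ β → cong g (++-assoc α σ β)))
            (∑-extensions r (α ++ σ))))) (∑-prefixes p σ))

    weightAt-error-bound : ∀ p r j →
      2 ^ p * extensionError r + prefixError p ≤ c * 2 ^ (p + (j + r)) + c * 2 ^ (p + (j + r))
    weightAt-error-bound p r j = +-mono-≤
      (begin
        2 ^ p * extensionError r ≤⟨ *-monoʳ-≤ (2 ^ p) (≤-trans (m≤m+n (extensionError r) c) (extensionError-bound r)) ⟩
        2 ^ p * (c * 2 ^ r) ≡⟨ lem (2 ^ p) c (2 ^ r) ⟩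
        c * (2 ^ p * 2 ^ r) ≡⟨ cong (c *_) (sym (^-distribˡ-+-* 2 p r)) ⟩
        c * 2 ^ (p + r) ≤⟨ *-monoʳ-≤ c (^-monoʳ-≤ 2 (+-monoʳ-≤ p (m≤n+m r j))) ⟩
        c * 2 ^ (p + (j + r)) ∎)
      (begin
        prefixError p ≤⟨ ≤-trans (m≤m+n (prefixError p) c) (prefixError-bound p) ⟩
        c * 2 ^ p ≤⟨ *-monoʳ-≤ c (^-monoʳ-≤ 2 (m≤m+n p (j + r))) ⟩
        c * 2 ^ (p + (j + r)) ∎)
      where
      open ≤-Reasoning
      lem : ∀ x c y → x * (c * y) ≡ c * (x * y)
      lem = solve-∀

    ∑-occurrences-≈ : ∀ J σ → length σ ≤ J →
      ∑ (words J) (λ τ → g τ * occurrences σ τ) ≈[ (J ∸ length σ) * (c * 2 ^ J + c * 2 ^ J) ] (J ∸ length σ) * g σ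
    ∑-occurrences-≈ J σ j≤J = ≈-congˡ (sym (∑-occurrences σ g J))
      (∑<-≈ (J ∸ length σ) (weightAt σ g (words J)) _ (g σ) weightAt-≈-inside)
      where
      j = length σ
      weightAt-≈-inside : ∀ p → p < J ∸ j → weightAt σ g (words J) p ≈[ c * 2 ^ J + c * 2 ^ J ] g σ
      weightAt-≈-inside p p<J∸j = subst (λ K → ∑ (words K) (λ τ → g τ * indicator (inCyl σ (shift p (τ ++ᵖ zeros))))
                                   ≈[ c * 2 ^ K + c * 2 ^ K ] g σ) p+j+r≡J
                               (≈-weaken (weightAt-error-bound p r j) (weightAt-≈ p r σ))
        where
        r = (J ∸ j) ∸ p
        p+j+r≡J : p + (j + r) ≡ J
        p+j+r≡J = begin
          p + (j + r) ≡⟨ x∙yz≈y∙xz p j r ⟩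
          j + (p + r) ≡⟨ cong (j +_) (m+[n∸m]≡n (<⇒≤ p<J∸j)) ⟩
          j + (J ∸ j) ≡⟨ m+[n∸m]≡n j≤J ⟩
          J ∎
          where open ≡-Reasoning

module UnitArithmetic where

  open import Data.Nat
  open import Data.Nat.Properties
  open import Data.Product using (_×_; _,_; proj₁; proj₂)
  open import Relation.Binary.PropositionalEquality
  open import Data.Nat.Tactic.RingSolver using (solve-∀)
  open NatApprox

  ≈16·4^J⇒bounds : ∀ J N → N ≈[ 4 * 2 ^ J + 4 ] 16 * (2 ^ J * 2 ^ J) →
    (8 * (2 ^ J * 2 ^ J) ≤ N) × (N ≤ 32 * (2 ^ J * 2 ^ J))
  ≈16·4^J⇒bounds J N (N≤ , ≤N) =
    +-cancelʳ-≤ (8 * HH) (8 * HH) N (≤-trans (≤-reflexive (lem₁ HH)) (≤-trans ≤N (+-monoʳ-≤ N 4H+4≤8HH))) ,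
    ≤-trans N≤ (≤-trans (+-monoʳ-≤ (16 * HH) (≤-trans 4H+4≤8HH (*-monoˡ-≤ HH (m≤m+n 8 8)))) (≤-reflexive (lem₂ HH)))
    where
    H = 2 ^ J
    HH = H * H
    1≤H : 1 ≤ H
    1≤H = m^n>0 2 J
    lem₀ : ∀ h → 4 * h + 4 * h ≡ 8 * h
    lem₀ = solve-∀
    4H+4≤8HH : 4 * H + 4 ≤ 8 * HH
    4H+4≤8HH = ≤-trans (+-mono-≤ (*-monoʳ-≤ 4 (≤-trans (≤-reflexive (sym (*-identityʳ H))) (*-monoʳ-≤ H 1≤H)))
                                 (*-monoʳ-≤ 4 (*-mono-≤ 1≤H 1≤H)))
                 (≤-reflexive (lem₀ HH))
    lem₁ : ∀ h → 8 * h + 8 * h ≡ 16 * h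
    lem₁ = solve-∀
    lem₂ : ∀ h → 16 * h + 16 * h ≡ 32 * h
    lem₂ = solve-∀

  -- W counts the windows σ (|σ| = j) inside one unit 0·B of a level-J block B made of N words;
  -- the conclusion says W / (1 + J N) is within 2^-L of X / 2^K. With H = 2^J and
  -- P = 16 H² = 2^(2J+4): S is the weighted count of occurrences inside the copies, G the
  -- level-(2J+4) weight of σ and X its level-K weight.
  module _ (J j K L W S N G X M : ℕ)
    (M+j≡J : M + j ≡ J)
    (W≈S : S ≤ W ≤+ (N * j + 1))
    (S≈MG : S ≈[ M * (4 * 2 ^ J + 4 * 2 ^ J) ] M * G)
    (G≈PX : 2 ^ K * G ≈[ 4 * (16 * (2 ^ J * 2 ^ J)) ] (16 * (2 ^ J * 2 ^ J)) * X)
    (N≈P : N ≈[ 4 * 2 ^ J + 4 ] 16 * (2 ^ J * 2 ^ J))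
    (X≤2Q : X ≤ 2 ^ K + 2 ^ K)
    (J-large : 32 * 2 ^ L * (j + 1) ≤ J)
    (K-large : 64 * 2 ^ L ≤ 2 ^ K)
    where

    private
      D = 2 ^ L
      Q = 2 ^ K
      H = 2 ^ J
      HH = H * H
      P = 16 * HH

      J≤H : J ≤ H
      J≤H = n≤2^n J

      1≤H : 1 ≤ H
      1≤H = m^n>0 2 J

      1≤HH : 1 ≤ HH
      1≤HH = *-mono-≤ 1≤H 1≤H

      M≤J : M ≤ J
      M≤J = ≤-trans (m≤m+n M j) (≤-reflexive M+j≡J)

      kD≤J : ∀ a → a ≤ 32 → a * D ≤ J
      kD≤J a a≤32 = ≤-trans (*-monoˡ-≤ D a≤32)
        (≤-trans (≤-trans (≤-reflexive (sym (*-identityʳ (32 * D)))) (*-monoʳ-≤ (32 * D) (m≤n+m 1 j))) J-large)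

      8HH≤N : 8 * HH ≤ N
      8HH≤N = proj₁ (≈16·4^J⇒bounds J N N≈P)

      N≤32HH : N ≤ 32 * HH
      N≤32HH = proj₂ (≈16·4^J⇒bounds J N N≈P)

      straddleError = D * Q * (N * j + 1)
      occurrenceError = D * Q * (M * (4 * H + 4 * H))
      rescaleError = D * M * (4 * P)
      prefixLengthError = D * j * (P * X)
      sizeError = D * J * X * (4 * H + 4)
      separatorError = D * X
      totalError = straddleError + occurrenceError + rescaleError + prefixLengthError + sizeError + separatorError

      chain : D * Q * W ≈[ totalError ] D * suc (J * N) * X
      chain =
        ≈-trans (≈-trans (≈-trans (≈-trans (≈-trans
          (≈-*ˡ (D * Q) (≤≤+⇒≈ W≈S))
          (≈-*ˡ (D * Q) S≈MG))
          (≈-congˡ (lem₁ D M Q G) (≈-*ˡ (D * M) G≈PX)))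
          (≈-congʳ (trans (lem₂ D M j (P * X)) (cong (λ z → D * z * (P * X)) M+j≡J)) (≈-+error (D * M * (P * X)) (D * j * (P * X)))))
          (≈-congˡ (lem₃ D J X P) (≈-*ˡ (D * J * X) (≈-sym N≈P))))
          (≈-congʳ (lem₄ D J X N) (≈-+error (D * J * X * N) (D * X)))
        where
        lem₁ : ∀ d m q g → d * m * (q * g) ≡ d * q * (m * g)
        lem₁ = solve-∀
        lem₂ : ∀ d m j y → d * m * y + d * j * y ≡ d * (m + j) * y
        lem₂ = solve-∀
        lem₃ : ∀ d j x p → d * j * x * p ≡ d * j * (p * x)
        lem₃ = solve-∀
        lem₄ : ∀ d j x n → d * j * x * n + d * x ≡ d * (1 + j * n) * x
        lem₄ = solve-∀

      open ≤-Reasoning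

      B = Q * J * HH

      straddleError≤ : straddleError ≤ B
      straddleError≤ = begin
        D * Q * (N * j + 1) ≤⟨ *-monoʳ-≤ (D * Q) (+-mono-≤ (*-monoˡ-≤ j N≤32HH) (≤-trans 1≤HH (m≤n*m HH 32))) ⟩
        D * Q * (32 * HH * j + 32 * HH) ≡⟨ lem D Q HH j ⟩
        (32 * D * (j + 1)) * (Q * HH) ≤⟨ *-monoˡ-≤ (Q * HH) J-large ⟩
        J * (Q * HH) ≡⟨ lem′ J Q HH ⟩
        B ∎
        where
        lem : ∀ d q h j → d * q * (32 * h * j + 32 * h) ≡ (32 * d * (j + 1)) * (q * h)
        lem = solve-∀
        lem′ : ∀ j q h → j * (q * h) ≡ q * j * h
        lem′ = solve-∀

      occurrenceError≤ : occurrenceError ≤ B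
      occurrenceError≤ = begin
        D * Q * (M * (4 * H + 4 * H)) ≤⟨ *-monoʳ-≤ (D * Q) (*-monoˡ-≤ (4 * H + 4 * H) M≤J) ⟩
        D * Q * (J * (4 * H + 4 * H)) ≡⟨ lem D Q J H ⟩
        (8 * D) * (Q * J * H) ≤⟨ *-monoˡ-≤ (Q * J * H) (≤-trans (kD≤J 8 (m≤m+n 8 24)) J≤H) ⟩
        H * (Q * J * H) ≡⟨ lem′ H Q J ⟩
        B ∎
        where
        lem : ∀ d q j h → d * q * (j * (4 * h + 4 * h)) ≡ (8 * d) * (q * j * h)
        lem = solve-∀
        lem′ : ∀ h q j → h * (q * j * h) ≡ q * j * (h * h)
        lem′ = solve-∀

      rescaleError≤ : rescaleError ≤ B
      rescaleError≤ = begin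
        D * M * (4 * P) ≤⟨ *-monoˡ-≤ (4 * P) (*-monoʳ-≤ D M≤J) ⟩
        D * J * (4 * (16 * HH)) ≡⟨ lem D J HH ⟩
        (64 * D) * (J * HH) ≤⟨ *-monoˡ-≤ (J * HH) K-large ⟩
        Q * (J * HH) ≡⟨ sym (*-assoc Q J HH) ⟩
        B ∎
        where
        lem : ∀ d j h → d * j * (4 * (16 * h)) ≡ (64 * d) * (j * h)
        lem = solve-∀

      prefixLengthError≤ : prefixLengthError ≤ B
      prefixLengthError≤ = begin
        D * j * (P * X) ≤⟨ *-monoʳ-≤ (D * j) (*-monoʳ-≤ P X≤2Q) ⟩
        D * j * (16 * HH * (Q + Q)) ≡⟨ lem D j HH Q ⟩
        (32 * D * j) * (Q * HH) ≤⟨ *-monoˡ-≤ (Q * HH) (≤-trans (*-monoʳ-≤ (32 * D) (m≤m+n j 1)) J-large) ⟩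
        J * (Q * HH) ≡⟨ lem′ J Q HH ⟩
        B ∎
        where
        lem : ∀ d j h q → d * j * (16 * h * (q + q)) ≡ (32 * d * j) * (q * h)
        lem = solve-∀
        lem′ : ∀ j q h → j * (q * h) ≡ q * j * h
        lem′ = solve-∀

      sizeError≤ : sizeError ≤ B
      sizeError≤ = begin
        D * J * X * (4 * H + 4) ≤⟨ *-mono-≤ (*-monoʳ-≤ (D * J) X≤2Q) (+-monoʳ-≤ (4 * H) (*-monoʳ-≤ 4 1≤H)) ⟩
        D * J * (Q + Q) * (4 * H + 4 * H) ≡⟨ lem D J Q H ⟩
        (16 * D) * (Q * J * H) ≤⟨ *-monoˡ-≤ (Q * J * H) (≤-trans (kD≤J 16 (m≤m+n 16 16)) J≤H) ⟩
        H * (Q * J * H) ≡⟨ lem′ H Q J ⟩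
        B ∎
        where
        lem : ∀ d j q h → d * j * (q + q) * (4 * h + 4 * h) ≡ (16 * d) * (q * j * h)
        lem = solve-∀
        lem′ : ∀ h q j → h * (q * j * h) ≡ q * j * (h * h)
        lem′ = solve-∀

      separatorError≤ : separatorError ≤ B
      separatorError≤ = begin
        D * X ≤⟨ *-monoʳ-≤ D X≤2Q ⟩
        D * (Q + Q) ≡⟨ lem D Q ⟩
        (2 * D) * Q ≤⟨ *-monoˡ-≤ Q (kD≤J 2 (m≤m+n 2 30)) ⟩
        J * Q ≤⟨ ≤-trans (≤-reflexive (sym (*-identityʳ (J * Q)))) (*-monoʳ-≤ (J * Q) 1≤HH) ⟩
        J * Q * HH ≡⟨ cong (_* HH) (*-comm J Q) ⟩
        B ∎
        where
        lem : ∀ d q → d * (q + q) ≡ (2 * d) * q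
        lem = solve-∀

      totalError≤ : totalError ≤ suc (J * N) * Q
      totalError≤ = begin
        totalError ≤⟨ +-mono-≤ (+-mono-≤ (+-mono-≤ (+-mono-≤ (+-mono-≤ straddleError≤ occurrenceError≤)
                         rescaleError≤) prefixLengthError≤) sizeError≤) separatorError≤ ⟩
        B + B + B + B + B + B ≤⟨ ≤-trans (≤-reflexive (lem B)) (m≤m+n (6 * B) (2 * B)) ⟩
        6 * B + 2 * B ≡⟨ lem′ Q J HH ⟩
        J * (8 * HH) * Q ≤⟨ *-monoˡ-≤ Q (*-monoʳ-≤ J 8HH≤N) ⟩
        J * N * Q ≤⟨ m≤n+m (J * N * Q) Q ⟩
        suc (J * N) * Q ∎
        where
        lem : ∀ b → b + b + b + b + b + b ≡ 6 * b
        lem = solve-∀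
        lem′ : ∀ q j h → 6 * (q * j * h) + 2 * (q * j * h) ≡ j * (8 * h) * q
        lem′ = solve-∀

    unit-frequency : 2 ^ L * 2 ^ K * W ≈[ suc (J * N) * 2 ^ K ] 2 ^ L * suc (J * N) * X
    unit-frequency = ≈-weaken totalError≤ chain

open import Defs
open import Data.Nat using (ℕ; suc; _≤_; _*_)
open NatApprox using (_≈[_]_)

-- Units of lengths ℓ u containing W u ≤ ℓ u windows, each unit from t₀ on having frequency
-- W u / ℓ u within Q / A of B / A. The frequency over a long enough prefix is then within
-- 2 Q / A of B / A, even when the prefix ends inside a unit.
module Accumulation (ℓ W : ℕ → ℕ) (A B Q t₀ : ℕ)
  (W≤ℓ : ∀ u → W u ≤ ℓ u)
  (unit-≈ : ∀ u → t₀ ≤ u → A * W u ≈[ ℓ u * Q ] ℓ u * B) where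

  open import Data.Nat
  open import Data.Nat.Properties
  open import Data.Product using (_,_; proj₁; proj₂)
  open import Relation.Binary.PropositionalEquality
  open import Data.Nat.Tactic.RingSolver using (solve-∀)
  open NatApprox
  open WordSums using (∑<)

  ∑W≤∑ℓ : ∀ t → ∑< t W ≤ ∑< t ℓ
  ∑W≤∑ℓ zero = z≤n
  ∑W≤∑ℓ (suc t) = +-mono-≤ (∑W≤∑ℓ t) (W≤ℓ t)

  ≈-bounded : ∀ {x a y b} → x ≤ a → y ≤ b → x ≈[ a + b ] y
  ≈-bounded {x} {a} {y} {b} x≤a y≤b =
    ≤-trans x≤a (≤-trans (m≤m+n a b) (m≤n+m (a + b) y)) ,
    ≤-trans y≤b (≤-trans (m≤n+m b a) (m≤n+m (a + b) x))

  initialError = (A + B) * ∑< t₀ ℓ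

  initial-≈ : A * ∑< t₀ W ≈[ initialError ] ∑< t₀ ℓ * B
  initial-≈ = ≈-cong-error (sym (*-distribʳ-+ (∑< t₀ ℓ) A B))
    (≈-bounded (*-monoʳ-≤ A (∑W≤∑ℓ t₀)) (≤-reflexive (*-comm (∑< t₀ ℓ) B)))

  accumulate : ∀ s → A * ∑< (t₀ + s) W ≈[ ∑< (t₀ + s) ℓ * Q + initialError ] ∑< (t₀ + s) ℓ * B
  accumulate zero rewrite +-identityʳ t₀ = ≈-weaken (m≤n+m _ _) initial-≈
  accumulate (suc s) rewrite +-suc t₀ s =
    ≈-cong-error (lem (∑< (t₀ + s) ℓ) Q initialError (ℓ (t₀ + s)))
      (≈-congˡ (sym (*-distribˡ-+ A (∑< (t₀ + s) W) (W (t₀ + s))))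
        (≈-congʳ (sym (*-distribʳ-+ B (∑< (t₀ + s) ℓ) (ℓ (t₀ + s))))
          (≈-+ (accumulate s) (unit-≈ (t₀ + s) (m≤m+n t₀ s)))))
    where
    lem : ∀ t q e l → t * q + e + l * q ≡ (t + l) * q + e
    lem = solve-∀

  accumulate-from : ∀ t → t₀ ≤ t → A * ∑< t W ≈[ ∑< t ℓ * Q + initialError ] ∑< t ℓ * B
  accumulate-from t t₀≤t =
    subst (λ z → A * ∑< z W ≈[ ∑< z ℓ * Q + initialError ] ∑< z ℓ * B) (m+[n∸m]≡n t₀≤t) (accumulate (t ∸ t₀))

  frequency-≈ : ∀ t n C → t₀ ≤ t → ∑< t ℓ ≤ n → n ≤ ∑< t ℓ + ℓ t →
    ∑< t W ≤ C ≤+ ℓ t → (A + B) * (∑< t₀ ℓ + ℓ t) ≤ n * Q →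
    A * C ≈[ n * Q + n * Q ] n * B
  frequency-≈ t n C t₀≤t n-lower n-upper (C-lower , C-upper) large = upper , lower
    where
    acc = accumulate-from t t₀≤t
    open ≤-Reasoning
    upper : A * C ≤ n * B + (n * Q + n * Q)
    upper = begin
      A * C ≤⟨ *-monoʳ-≤ A C-upper ⟩
      A * (∑< t W + ℓ t) ≡⟨ *-distribˡ-+ A (∑< t W) (ℓ t) ⟩
      A * ∑< t W + A * ℓ t ≤⟨ +-monoˡ-≤ (A * ℓ t) (proj₁ acc) ⟩
      ∑< t ℓ * B + (∑< t ℓ * Q + initialError) + A * ℓ t
        ≤⟨ +-monoˡ-≤ (A * ℓ t) (+-mono-≤ (*-monoˡ-≤ B n-lower) (+-monoˡ-≤ initialError (*-monoˡ-≤ Q n-lower))) ⟩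
      n * B + (n * Q + initialError) + A * ℓ t ≤⟨ +-monoʳ-≤ (n * B + (n * Q + initialError)) (*-monoˡ-≤ (ℓ t) (m≤m+n A B)) ⟩
      n * B + (n * Q + initialError) + (A + B) * ℓ t ≡⟨ lem (n * B) (n * Q) (A + B) (∑< t₀ ℓ) (ℓ t) ⟩
      n * B + (n * Q + (A + B) * (∑< t₀ ℓ + ℓ t)) ≤⟨ +-monoʳ-≤ (n * B) (+-monoʳ-≤ (n * Q) large) ⟩
      n * B + (n * Q + n * Q) ∎
      where
      lem : ∀ x y a t l → x + (y + a * t) + a * l ≡ x + (y + a * (t + l))
      lem = solve-∀
    lower : n * B ≤ A * C + (n * Q + n * Q)
    lower = begin
      n * B ≤⟨ *-monoˡ-≤ B n-upper ⟩
      (∑< t ℓ + ℓ t) * B ≡⟨ *-distribʳ-+ B (∑< t ℓ) (ℓ t) ⟩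
      ∑< t ℓ * B + ℓ t * B ≤⟨ +-monoˡ-≤ (ℓ t * B) (proj₂ acc) ⟩
      A * ∑< t W + (∑< t ℓ * Q + initialError) + ℓ t * B
        ≤⟨ +-monoˡ-≤ (ℓ t * B) (+-mono-≤ (*-monoʳ-≤ A C-lower) (+-monoˡ-≤ initialError (*-monoˡ-≤ Q n-lower))) ⟩
      A * C + (n * Q + initialError) + ℓ t * B ≤⟨ +-monoʳ-≤ (A * C + (n * Q + initialError)) (*-monoʳ-≤ (ℓ t) (m≤n+m B A)) ⟩
      A * C + (n * Q + initialError) + ℓ t * (A + B) ≡⟨ lem (A * C) (n * Q) (A + B) (∑< t₀ ℓ) (ℓ t) ⟩
      A * C + (n * Q + (A + B) * (∑< t₀ ℓ + ℓ t)) ≤⟨ +-monoʳ-≤ (A * C) (+-monoʳ-≤ (n * Q) large) ⟩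
      A * C + (n * Q + n * Q) ∎
      where
      lem : ∀ x y a t l → x + (y + a * t) + l * a ≡ x + (y + a * (t + l))
      lem = solve-∀

-- The levels of the units when level J is used for 1 + R J consecutive units.
module Levels (R : ℕ → ℕ) where

  open import Data.Nat
  open import Data.Nat.Properties
  open import Data.Product using (_×_; _,_; proj₁; proj₂)
  open import Relation.Binary.PropositionalEquality
  open import Relation.Nullary using (yes; no; contradiction)
  open WordSums using (∑<)

  -- number of units of level < J
  start : ℕ → ℕ
  start J = ∑< J (λ i → suc (R i))

  start-mono : ∀ {a b} → a ≤ b → start a ≤ start b
  start-mono {a} {b} a≤b = subst (λ z → start a ≤ start z) (m+[n∸m]≡n a≤b) (extend a (b ∸ a))
    where
    extend : ∀ a d → start a ≤ start (a + d)
    extend a zero = ≤-reflexive (cong start (sym (+-identityʳ a)))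
    extend a (suc d) = ≤-trans (extend a d) (≤-trans (m≤m+n (start (a + d)) _) (≤-reflexive (cong start (sym (+-suc a d)))))

  level : ℕ → ℕ
  level zero = 0
  level (suc t) with suc t <? start (suc (level t))
  ... | yes _ = level t
  ... | no _ = suc (level t)

  level-spec : ∀ t → start (level t) ≤ t × t < start (suc (level t))
  level-spec zero = z≤n , s≤s z≤n
  level-spec (suc t) with suc t <? start (suc (level t)) | level-spec t
  ... | yes t+1<s | s≤t , _ = ≤-trans s≤t (n≤1+n t) , t+1<s
  ... | no t+1≮s | _ , t<s = ≮⇒≥ t+1≮s ,
    ≤-trans (s≤s t<s) (≤-trans (≤-reflexive (+-comm 1 _)) (+-monoʳ-≤ (start (suc (level t))) (s≤s z≤n)))

  level-large : ∀ J t → start (suc J) ≤ t → J < level t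
  level-large J t s≤t with level t ≤? J
  ... | no lt≰J = ≰⇒> lt≰J
  ... | yes lt≤J = contradiction (<-≤-trans (proj₂ (level-spec t)) (start-mono (s≤s lt≤J))) (≤⇒≯ s≤t)

  level-small : ∀ J t → t < start (suc J) → level t ≤ J
  level-small J t t<s with level t ≤? J
  ... | yes lt≤J = lt≤J
  ... | no lt≰J = contradiction (≤-trans (start-mono (≰⇒> lt≰J)) (proj₁ (level-spec t))) (<⇒≱ t<s)

  -- all 1 + R J units of level J precede any unit of level J + 1
  R≤-of-level : ∀ t J → level t ≡ suc J → R J ≤ t
  R≤-of-level t J lt≡J+1 = ≤-trans (≤-trans (n≤1+n (R J)) (m≤n+m _ (start J)))
    (subst (λ z → start z ≤ t) lt≡J+1 (proj₁ (level-spec t)))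


module Concatenation (blk : ℕ → Str) (R : ℕ → ℕ) where

  open import Defs
  open import Data.Bool using (false)
  open import Data.List using ([]; _∷_; length)
  open import Data.Nat
  open import Data.Nat.Properties
  open import Data.Product using (Σ; _×_; _,_)
  open import Relation.Binary.PropositionalEquality
  open import Relation.Nullary using (yes; no)
  open NatApprox
  open Windows
  open WordSums using (∑<)
  open Levels R public

  -- run xs t emits xs, then the units t, t + 1, …
  run : Str → ℕ → Point
  run (x ∷ xs) t zero = x
  run (x ∷ xs) t (suc n) = run xs t n
  run [] t zero = false
  run [] t (suc n) = run (blk (level t)) (suc t) n

  ω₀ : Point
  ω₀ = run [] 0

  run-∷ : ∀ xs t → run xs t ≗ xs ++ᵖ run [] t
  run-∷ [] t k = refl
  run-∷ (x ∷ xs) t zero = refl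
  run-∷ (x ∷ xs) t (suc k) = run-∷ xs t k

  run-[] : ∀ t → run [] t ≗ (false ∷ blk (level t)) ++ᵖ run [] (suc t)
  run-[] t zero = refl
  run-[] t (suc k) = run-∷ (blk (level t)) (suc t) k

  unitLength : ℕ → ℕ
  unitLength t = suc (length (blk (level t)))

  T : ℕ → ℕ
  T t = ∑< t unitLength

  shift-T : ∀ t → shift (T t) ω₀ ≗ run [] t
  shift-T zero k = refl
  shift-T (suc t) k = begin
    ω₀ ((T t + unitLength t) + k) ≡⟨ cong ω₀ (+-assoc (T t) (unitLength t) k) ⟩
    shift (unitLength t) (shift (T t) ω₀) k ≡⟨ shift-T t (unitLength t + k) ⟩
    shift (unitLength t) (run [] t) k ≡⟨ run-[] t (unitLength t + k) ⟩
    shift (unitLength t) ((false ∷ blk (level t)) ++ᵖ run [] (suc t)) k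
      ≡⟨ shift-++ᵖ (false ∷ blk (level t)) (run [] (suc t)) k ⟩
    run [] (suc t) k ∎
    where open ≡-Reasoning

  t≤T : ∀ t → t ≤ T t
  t≤T zero = z≤n
  t≤T (suc t) = ≤-trans (≤-reflexive (+-comm 1 t)) (+-mono-≤ (t≤T t) (s≤s z≤n))

  T-mono : ∀ {a b} → a ≤ b → T a ≤ T b
  T-mono {a} {b} a≤b = subst (λ z → T a ≤ T z) (m+[n∸m]≡n a≤b) (extend a (b ∸ a))
    where
    extend : ∀ a d → T a ≤ T (a + d)
    extend a zero = ≤-reflexive (cong T (sym (+-identityʳ a)))
    extend a (suc d) = ≤-trans (extend a d) (≤-trans (m≤m+n (T (a + d)) _) (≤-reflexive (cong T (sym (+-suc a d)))))

  locate : ∀ n → Σ ℕ λ t → T t ≤ n × n < T (suc t)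
  locate zero = 0 , z≤n , s≤s z≤n
  locate (suc n) with locate n
  ... | t , T≤n , n<T with suc n <? T (suc t)
  ...   | yes n+1<T = t , ≤-trans T≤n (n≤1+n n) , n+1<T
  ...   | no n+1≮T = suc t , ≮⇒≥ n+1≮T ,
      ≤-trans (s≤s n<T) (≤-trans (≤-reflexive (+-comm 1 (T (suc t)))) (+-monoʳ-≤ (T (suc t)) (s≤s z≤n)))

  -- windows σ starting in unit t
  unitCount : Str → ℕ → ℕ
  unitCount σ t = count σ (run [] t) (unitLength t)

  unitCount-block : ∀ σ t →
    count σ (blk (level t) ++ᵖ run [] (suc t)) (length (blk (level t))) ≤ unitCount σ t ≤+ 1
  unitCount-block σ t rewrite count-cong σ (run-[] t) (unitLength t)
    | count-+ σ ((false ∷ blk (level t)) ++ᵖ run [] (suc t)) 1 (length (blk (level t))) =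
    m≤n+m _ _ , ≤-trans (+-monoˡ-≤ _ (count≤n σ _ 1)) (≤-reflexive (+-comm 1 _))

  count-T : ∀ σ t → count σ ω₀ (T t) ≡ ∑< t (unitCount σ)
  count-T σ zero = refl
  count-T σ (suc t) = trans (count-+ σ ω₀ (T t) (unitLength t))
    (cong₂ _+_ (count-T σ t) (count-cong σ (shift-T t) (unitLength t)))

module Construction where

  open import Defs
  open import Data.List using ([]; length)
  open import Data.Nat
  open import Data.Nat.Properties
  open import Data.Product using (_,_; proj₁; proj₂)
  open import Relation.Binary.PropositionalEquality hiding (J)
  open import Relation.Nullary using (yes; no; contradiction)
  open import Data.Nat.Tactic.RingSolver using (solve-∀)
  import Data.Rational as ℚ
  open NatApprox
  open Windows
  open WordSums
  open Blocks
  open UnitArithmetic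
  open RepresentationWeights
  open RationalApprox using (precision; 4*2^-precision≤)

  -- blocks of level J are built from weights of level 2J + 4, i.e. of total about 16 · 4^J
  weightLevel : ℕ → ℕ
  weightLevel J = J + J + 4

  2^weightLevel : ∀ J → 2 ^ weightLevel J ≡ 16 * (2 ^ J * 2 ^ J)
  2^weightLevel J = trans (^-distribˡ-+-* 2 (J + J) 4)
    (trans (cong (_* 16) (^-distribˡ-+-* 2 J J)) (*-comm (2 ^ J * 2 ^ J) 16))

  levelBlock : Rep → ℕ → Str
  levelBlock f J = block (words J) (weight f (weightLevel J))

  -- a bound for the length of the units of level J
  U : ℕ → ℕ
  U J = 2 ^ (J + J + J + 6)

  -- level J is used for 1 + repetitions J units, which makes the units of level J + 1 short
  -- compared with their starting position
  repetitions : ℕ → ℕ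
  repetitions J = suc J * U (suc J)

  Φ : Rep → Point
  Φ f = Concatenation.ω₀ (levelBlock f) repetitions

  weightPrecision : ℕ → ℚ.ℚ → ℕ
  weightPrecision j ε = precision ε + j + 7

  firstLevel : ℕ → ℚ.ℚ → ℕ
  firstLevel j ε = 32 * 2 ^ precision ε * (j + 1) + weightPrecision j ε

  -- the units of level ≤ firstLevel j ε make up a negligible part of any prefix of length m j ε
  m : ℕ → ℚ.ℚ → ℕ
  m j ε = 6 * 2 ^ precision ε * (Levels.start repetitions (suc (firstLevel j ε)) * U (firstLevel j ε)) + 1

  U-mono : ∀ {a b} → a ≤ b → U a ≤ U b
  U-mono a≤b = ^-monoʳ-≤ 2 (+-monoˡ-≤ 6 (+-mono-≤ (+-mono-≤ a≤b a≤b) a≤b))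

  module Properties {ν : Str → ℝ} (isμ : IsShiftInvProbMeasure ν) {f : Rep} (isR : IsRepresentation ν f) where

    open Concatenation (levelBlock f) repetitions

    module Weights k = AlmostAdditivity.Weights (weight f k) 4 (weight-additiveʳ isμ isR k) (weight-additiveˡ isμ isR k)

    blockSize : ℕ → ℕ
    blockSize J = ∑ (words J) (weight f (weightLevel J))

    length-levelBlock : ∀ J → length (levelBlock f J) ≡ J * blockSize J
    length-levelBlock J = length-block J (words J) (weight f (weightLevel J)) (words-length J)

    blockSize-≈ : ∀ J → blockSize J ≈[ 4 * 2 ^ J + 4 ] 16 * (2 ^ J * 2 ^ J)
    blockSize-≈ J = ≈-congʳ (2^weightLevel J)
      (≈-weaken (+-monoˡ-≤ 4 (≤-trans (m≤m+n _ 4) (Weights.extensionError-bound (weightLevel J) J)))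
        (≈-trans (Weights.∑-extensions (weightLevel J) J []) (weight-[] isμ isR (weightLevel J))))

    blockSize≤ : ∀ J → blockSize J ≤ 32 * (2 ^ J * 2 ^ J)
    blockSize≤ J = proj₂ (≈16·4^J⇒bounds J (blockSize J) (blockSize-≈ J))

    unitLength≤U : ∀ t → unitLength t ≤ U (level t)
    unitLength≤U t = begin
      suc (length (levelBlock f J)) ≡⟨ cong suc (length-levelBlock J) ⟩
      1 + J * blockSize J ≤⟨ +-monoʳ-≤ 1 (*-mono-≤ (n≤2^n J) (blockSize≤ J)) ⟩
      1 + H * (32 * (H * H)) ≤⟨ +-monoˡ-≤ (H * (32 * (H * H))) 1≤32H³ ⟩
      32 * (H * (H * H)) + H * (32 * (H * H)) ≡⟨ lem H ⟩
      H * H * H * 64 ≡⟨ cong (_* 64) (sym (trans (^-distribˡ-+-* 2 (J + J) J) (cong (_* H) (^-distribˡ-+-* 2 J J)))) ⟩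
      2 ^ (J + J + J) * 2 ^ 6 ≡⟨ sym (^-distribˡ-+-* 2 (J + J + J) 6) ⟩
      U J ∎
      where
      open ≤-Reasoning
      J = level t
      H = 2 ^ J
      1≤32H³ : 1 ≤ 32 * (H * (H * H))
      1≤32H³ = ≤-trans (*-mono-≤ (m^n>0 2 J) (*-mono-≤ (m^n>0 2 J) (m^n>0 2 J))) (m≤n*m _ 32)
      lem : ∀ h → 32 * (h * (h * h)) + h * (32 * (h * h)) ≡ h * h * h * 64
      lem = solve-∀

    weight≤ : ∀ K σ → weight f K σ ≤ 2 ^ K + (4 * 2 ^ length σ + 4)
    weight≤ K σ = begin
      weight f K σ ≤⟨ Weights.g≤g[] K σ ⟩
      weight f K [] + 4 * 2 ^ length σ ≤⟨ +-monoˡ-≤ (4 * 2 ^ length σ) (proj₁ (weight-[] isμ isR K)) ⟩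
      2 ^ K + 4 + 4 * 2 ^ length σ ≡⟨ lem (2 ^ K) (2 ^ length σ) ⟩
      2 ^ K + (4 * 2 ^ length σ + 4) ∎
      where
      open ≤-Reasoning
      lem : ∀ a b → a + 4 + 4 * b ≡ a + (4 * b + 4)
      lem = solve-∀

    unitCount-≈ : ∀ σ L K t → 32 * 2 ^ L * (length σ + 1) ≤ level t → 64 * 2 ^ L ≤ 2 ^ K →
      K ≤ weightLevel (level t) → 4 * 2 ^ length σ + 4 ≤ 2 ^ K →
      2 ^ L * 2 ^ K * unitCount σ t ≈[ unitLength t * 2 ^ K ] unitLength t * (2 ^ L * weight f K σ)
    unitCount-≈ σ L K t J-large K-large K≤k 4·2^j+4≤Q =
      ≈-congʳ D*ℓ*X≡ (≈-cong-error (cong (_* 2 ^ K) (sym ℓ≡))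
        (unit-frequency J j K L (unitCount σ t) S N (weight f k σ) (weight f K σ) (J ∸ j)
          (m∸n+n≡m j≤J) W≈S S≈MG G≈PX (blockSize-≈ J) X≤2Q J-large K-large))
      where
      J = level t
      k = weightLevel J
      j = length σ
      N = blockSize J
      S = ∑ (words J) (λ τ → weight f k τ * occurrences σ τ)
      j≤J : j ≤ J
      j≤J = ≤-trans (≤-trans (m≤m+n j 1) (m≤n*m (j + 1) (32 * 2 ^ L) {{>-nonZero (*-mono-≤ {1} {32} (s≤s z≤n) (m^n>0 2 L))}})) J-large
      W≈S : S ≤ unitCount σ t ≤+ (N * j + 1)
      W≈S = ≤≤+-trans (count-block σ (words J) (weight f k) (run [] (suc t))) (unitCount-block σ t)
      S≈MG : S ≈[ (J ∸ j) * (4 * 2 ^ J + 4 * 2 ^ J) ] (J ∸ j) * weight f k σ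
      S≈MG = Weights.∑-occurrences-≈ k J σ j≤J
      G≈PX : 2 ^ K * weight f k σ ≈[ 4 * (16 * (2 ^ J * 2 ^ J)) ] 16 * (2 ^ J * 2 ^ J) * weight f K σ
      G≈PX = subst (λ z → 2 ^ K * weight f k σ ≈[ 4 * z ] z * weight f K σ) (2^weightLevel J)
               (weight-rescale isμ isR K k σ K≤k)
      X≤2Q : weight f K σ ≤ 2 ^ K + 2 ^ K
      X≤2Q = ≤-trans (weight≤ K σ) (+-monoʳ-≤ (2 ^ K) 4·2^j+4≤Q)
      ℓ≡ : unitLength t ≡ suc (J * N)
      ℓ≡ = cong suc (length-levelBlock J)
      D*ℓ*X≡ : 2 ^ L * suc (J * N) * weight f K σ ≡ unitLength t * (2 ^ L * weight f K σ)
      D*ℓ*X≡ = trans (lem (2 ^ L) (suc (J * N)) (weight f K σ)) (cong (_* (2 ^ L * weight f K σ)) (sym ℓ≡))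
        where
        lem : ∀ d l x → d * l * x ≡ l * (d * x)
        lem = solve-∀

    T≤ : ∀ J t → t ≤ start (suc J) → T t ≤ t * U J
    T≤ J zero _ = z≤n
    T≤ J (suc t) t<s = ≤-trans (+-mono-≤ (T≤ J t (≤-trans (n≤1+n t) t<s))
      (≤-trans (unitLength≤U t) (U-mono (level-small J t t<s)))) (≤-reflexive (+-comm (t * U J) (U J)))

    level*U≤ : ∀ t → level t * U (level t) ≤ t
    level*U≤ t with level t in eq
    ... | zero = z≤n
    ... | suc J = R≤-of-level t J eq

    module _ (σ : Str) (ε : ℚ.ℚ) where

      private
        j = length σ
        L = precision ε
        K = weightPrecision j ε
        J₀ = firstLevel j ε
        t₀ = start (suc J₀)
        D = 2 ^ L
        Q = 2 ^ K
        X = weight f K σ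

        Q≡ : Q ≡ D * 2 ^ j * 128
        Q≡ = trans (^-distribˡ-+-* 2 (L + j) 7) (cong (_* 128) (^-distribˡ-+-* 2 L j))

        64D≤Q : 64 * D ≤ Q
        64D≤Q = ≤-trans (≤-reflexive (*-comm 64 D))
          (≤-trans (*-mono-≤ (≤-trans (≤-reflexive (sym (*-identityʳ D))) (*-monoʳ-≤ D (m^n>0 2 j))) (m≤m+n 64 64))
            (≤-reflexive (sym Q≡)))

        4·2^j+4≤Q : 4 * 2 ^ j + 4 ≤ Q
        4·2^j+4≤Q = ≤-trans (+-monoʳ-≤ (4 * 2 ^ j) (*-monoʳ-≤ 4 (m^n>0 2 j)))
          (≤-trans (≤-reflexive (lem (2 ^ j))) (≤-trans (*-mono-≤ (*-monoˡ-≤ (2 ^ j) (m^n>0 2 L)) (m≤m+n 8 120))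
            (≤-reflexive (sym Q≡))))
          where
          lem : ∀ x → 4 * x + 4 * x ≡ 1 * x * 8
          lem = solve-∀

        X≤2Q : X ≤ Q + Q
        X≤2Q = ≤-trans (weight≤ K σ) (+-monoʳ-≤ Q 4·2^j+4≤Q)

        J₀-large : 32 * D * (j + 1) ≤ J₀
        J₀-large = m≤m+n _ K

        6D≤J₀ : 6 * D ≤ J₀
        6D≤J₀ = ≤-trans (*-monoˡ-≤ D (m≤m+n 6 26)) (≤-trans (m≤m*n (32 * D) (j + 1) {{>-nonZero (m≤n+m 1 j)}}) J₀-large)

        K≤J₀ : K ≤ J₀
        K≤J₀ = m≤n+m K _

      unitCount-≈-late : ∀ u → t₀ ≤ u → D * Q * unitCount σ u ≈[ unitLength u * Q ] unitLength u * (D * X)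
      unitCount-≈-late u t₀≤u = unitCount-≈ σ L K u (≤-trans J₀-large (<⇒≤ J₀<lu)) 64D≤Q
        (≤-trans K≤J₀ (≤-trans (<⇒≤ J₀<lu) (≤-trans (m≤m+n (level u) (level u)) (m≤m+n (level u + level u) 4)))) 4·2^j+4≤Q
        where
        J₀<lu : J₀ < level u
        J₀<lu = level-large J₀ u t₀≤u

      open Accumulation unitLength (unitCount σ) (D * Q) (D * X) Q t₀
        (λ u → count≤n σ (run [] u) (unitLength u)) unitCount-≈-late

      module _ (k : ℕ) (m≤n : m j ε ≤ suc k) where

        private
          n = suc k
          l = proj₁ (locate n)
          T≤n : T l ≤ n
          T≤n = proj₁ (proj₂ (locate n))
          n<T : n < T (suc l)
          n<T = proj₂ (proj₂ (locate n))

        6DT≤n : 6 * D * T t₀ ≤ n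
        6DT≤n = ≤-trans (*-monoʳ-≤ (6 * D) (T≤ J₀ t₀ ≤-refl)) (≤-trans (m≤m+n _ 1) m≤n)

        t₀≤l : t₀ ≤ l
        t₀≤l with t₀ ≤? l
        ... | yes t₀≤l = t₀≤l
        ... | no t₀≰l = contradiction (<-≤-trans n<T (≤-trans (T-mono (≰⇒> t₀≰l)) T≤6DT)) (≤⇒≯ 6DT≤n)
          where
          T≤6DT : T t₀ ≤ 6 * D * T t₀
          T≤6DT = m≤n*m (T t₀) (6 * D) {{>-nonZero (*-mono-≤ {1} {6} (s≤s z≤n) (m^n>0 2 L))}}

        6Dℓ≤n : 6 * D * unitLength l ≤ n
        6Dℓ≤n = begin
          6 * D * unitLength l ≤⟨ *-mono-≤ (≤-trans 6D≤J₀ (<⇒≤ (level-large J₀ l t₀≤l))) (unitLength≤U l) ⟩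
          level l * U (level l) ≤⟨ level*U≤ l ⟩
          l ≤⟨ t≤T l ⟩
          T l ≤⟨ T≤n ⟩
          n ∎
          where open ≤-Reasoning

        prefix-long : (D * Q + D * X) * (T t₀ + unitLength l) ≤ n * Q
        prefix-long = begin
          (D * Q + D * X) * (T t₀ + unitLength l) ≤⟨ *-monoˡ-≤ (T t₀ + unitLength l) (+-monoʳ-≤ (D * Q) (*-monoʳ-≤ D X≤2Q)) ⟩
          (D * Q + D * (Q + Q)) * (T t₀ + unitLength l) ≡⟨ lem D Q (T t₀ + unitLength l) ⟩
          Q * (3 * D * (T t₀ + unitLength l)) ≤⟨ *-monoʳ-≤ Q 3D[T+ℓ]≤n ⟩
          Q * n ≡⟨ *-comm Q n ⟩
          n * Q ∎
          where
          open ≤-Reasoning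
          lem : ∀ d q s → (d * q + d * (q + q)) * s ≡ q * (3 * d * s)
          lem = solve-∀
          lem′ : ∀ d x y → 2 * (3 * d * (x + y)) ≡ 6 * d * x + 6 * d * y
          lem′ = solve-∀
          3D[T+ℓ]≤n : 3 * D * (T t₀ + unitLength l) ≤ n
          3D[T+ℓ]≤n = *-cancelˡ-≤ 2 (≤-trans (≤-reflexive (lem′ D (T t₀) (unitLength l)))
            (≤-trans (+-mono-≤ 6DT≤n 6Dℓ≤n) (≤-reflexive (cong (n +_) (sym (+-identityʳ n))))))

        count-between : ∑< l (unitCount σ) ≤ count σ ω₀ n ≤+ unitLength l
        count-between = subst₂ (λ a b → a ≤ count σ ω₀ b ≤+ unitLength l) (count-T σ l) (m+[n∸m]≡n T≤n)
          (≤≤+-weaken (count-extend σ ω₀ (T l) (n ∸ T l))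
            (+-cancelˡ-≤ (T l) (n ∸ T l) (unitLength l) (≤-trans (≤-reflexive (m+[n∸m]≡n T≤n)) (<⇒≤ n<T))))

        prefix-frequency-≈ : D * Q * count σ ω₀ n ≈[ 2 * n * Q ] D * n * X
        prefix-frequency-≈ = ≈-cong-error (lem n Q) (≈-congʳ (lem′ n D X)
          (frequency-≈ l n (count σ ω₀ n) t₀≤l T≤n (<⇒≤ n<T) count-between prefix-long))
          where
          lem : ∀ n q → n * q + n * q ≡ 2 * n * q
          lem = solve-∀
          lem′ : ∀ n d x → n * (d * x) ≡ d * n * x
          lem′ = solve-∀

    average-DistLt : ∀ σ ε → ℚ.0ℚ ℚ.< ε → ∀ k → m (length σ) ε ≤ suc k → DistLt (ν σ) (avg σ (Φ f) k) ε
    average-DistLt σ ε 0<ε k m≤n = DistLt-weaken {ν σ}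
      (frequency-DistLt isμ isR σ K L k (count σ ω₀ (suc k)) L≤K (prefix-frequency-≈ σ ε k m≤n))
      (4*2^-precision≤ ε 0<ε)
      where
      L = precision ε
      K = weightPrecision (length σ) ε
      L≤K : L ≤ K
      L≤K = ≤-trans (m≤m+n L (length σ)) (m≤m+n (L + length σ) 7)

open import Data.List using (length)
open import Data.Rational using (ℚ; 0ℚ; _<_)
open import Data.Product using (Σ; _×_; _,_)
open Construction using (m; Φ; module Properties)

theorem4p2 : Σ (ℕ → ℚ → ℕ) λ m → Σ (Rep → Point) λ Φ →
    ∀ (ν : Str → ℝ) → IsShiftInvProbMeasure ν →
    ∀ (f : Rep) → IsRepresentation ν f →
    Generic ν (Φ f) ×
    (∀ σ (ε : ℚ) → 0ℚ < ε → ∀ k → m (length σ) ε ≤ suc k →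
    DistLt (ν σ) (avg σ (Φ f) k) ε)
theorem4p2 = m , Φ , λ ν isμ f isR →
  (λ σ ε 0<ε → m (length σ) ε , Properties.average-DistLt isμ isR σ ε 0<ε) ,
  Properties.average-DistLt isμ isR
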